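{- For any tree $T$, $L_1(T)+1\leq L_2(T)\leq 2L_1(T)$. Moreover, $L_1(T)+1= L_2(T)$ if and only if $T$ is a $t$-spider for some integer $t$ with $0\leq t<\Delta(T)$.
   Context: All graphs (in particular trees) are finite, undirected, simple and nontrivial (at least two vertices). $\Delta(T)$ is the maximum degree. A star is a tree with diameter at most $2$. A $t$-spider is a tree obtained from a star by subdividing $t$ of its edges once each. $N[v]=\{v\}\cup N(v)$ is the closed neighbourhood of $v$. For an integer $k\ge 1$, a set $B\subseteq V(G)$ is a $k$-limited packing if $|N[v]\cap B|\le k$ for every vertex $v$ of $G$; $L_k(G)$ is the maximum cardinality of a $k$-limited packing in $G$. -}

module Defs where

open import Data.Bool.Base using (true; false)
open import Data.Empty using (⊥)
open import Data.Fin.Base using (Fin)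
open import Data.Fin.Properties using (_≟_; all?)
open import Data.Fin.Subset using (Subset; inside; outside; ⁅_⁆; _∪_; _∩_; ∣_∣)
open import Data.Fin.Subset.Properties using (∣⊥∣≡0; p∩q⊆q; p⊆q⇒∣p∣≤∣q∣)
import Data.Fin.Subset as Subset
open import Data.List.Base using (List; []; _∷_; [_]; _++_; map; filter; allFin)
open import Data.List.Extrema.Nat using (max; argmax-sel; xs≤max)
open import Data.List.Membership.Propositional using (_∈_)
open import Data.List.Membership.Propositional.Properties
  using (∈-map⁺; ∈-map⁻; ∈-++⁺ˡ; ∈-++⁺ʳ; ∈-filter⁺; ∈-filter⁻)
open import Data.List.Relation.Unary.All using (lookup)
open import Data.List.Relation.Unary.Any using (here)
open import Data.List.Relation.Unary.Unique.Propositional using (Unique)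
open import Data.Nat.Base using (ℕ; zero; suc; _≤_; z≤n)
open import Data.Nat.Properties using (_≤?_; ≤-trans; ≤-reflexive)
open import Data.Product.Base using (Σ-syntax; ∃-syntax; _×_; _,_)
open import Data.Sum.Base using (_⊎_; inj₁; inj₂; swap)
open import Data.Vec.Base using ([]; _∷_; tabulate)
open import Function.Base using (_∘_; id)
open import Function.Bundles using (_↔_; _⇔_; Inverse)
open import Relation.Binary.PropositionalEquality using (_≡_; refl; subst; sym)
open import Relation.Nullary using (¬_; Dec; yes; no; does)
open import Relation.Nullary.Decidable using (_×-dec_; _⊎-dec_; ¬?)

-- Simple graphs.  Finite graphs are those of type Graph (Fin n); other vertex
-- types occur only as intermediate, visibly finite ones (see subdivide).
-- Adjacency is decidable so that neighbourhoods are computable subsets.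

record Graph (V : Set) : Set₁ where
  field
    Adj     : V → V → Set
    adj?    : ∀ u v → Dec (Adj u v)
    adj-sym : ∀ {u v} → Adj u v → Adj v u
    irrefl  : ∀ {v} → ¬ Adj v v

open Graph public

infix 4 _≅_

_≅_ : {V W : Set} → Graph V → Graph W → Set
_≅_ {V} {W} G H =
  Σ[ f ∈ V ↔ W ] (∀ u v → Adj G u v ⇔ Adj H (Inverse.to f u) (Inverse.to f v))

-- Walk G u v ℓ: the walks with ℓ edges from u to v.

data Walk {V : Set} (G : Graph V) : V → V → ℕ → Set where
  nil  : ∀ {v} → Walk G v v 0
  cons : ∀ {u v w ℓ} → Adj G u v → Walk G v w ℓ → Walk G u w (suc ℓ)

vertices : ∀ {V} {G : Graph V} {u v ℓ} → Walk G u v ℓ → List V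
vertices {u = u} nil        = [ u ]
vertices {u = u} (cons _ w) = u ∷ vertices w

IsPath : ∀ {V} {G : Graph V} {u v ℓ} → Walk G u v ℓ → Set
IsPath w = Unique (vertices w)

Connected : ∀ {V} → Graph V → Set
Connected G = ∀ u v → ∃[ ℓ ] Walk G u v ℓ

-- A cycle is a path with at least two edges together with an edge joining its
-- last vertex to its first.

record Cycle {V : Set} (G : Graph V) : Set where
  field
    {first last} : V
    {len}        : ℕ
    walk         : Walk G first last len
    isPath       : IsPath walk
    2≤len        : 2 ≤ len
    closing      : Adj G last first

record IsTree {V : Set} (G : Graph V) : Set where
  field
    connected : Connected G
    acyclic   : ¬ Cycle G

HasDistance : ∀ {V} → Graph V → V → V → ℕ → Set
HasDistance G u v d = Walk G u v d × (∀ {ℓ} → Walk G u v ℓ → d ≤ ℓ)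

-- d is the maximum of the distances between two vertices.

HasDiameter : ∀ {V} → Graph V → ℕ → Set
HasDiameter {V} G d =
    (∀ u v → ∃[ e ] (HasDistance G u v e × e ≤ d))
  × (∃[ u ] ∃[ v ] HasDistance G u v d)

record IsStar {n : ℕ} (S : Graph (Fin n)) : Set where
  field
    nontrivial : 2 ≤ n
    isTree     : IsTree S
    diameter≤2 : ∃[ d ] (HasDiameter S d × d ≤ 2)

-- t distinct edges of G.  Each edge is listed with an arbitrary orientation,
-- so distinctness has to exclude repetition in either orientation.

Joins : {V : Set} → V → V → V → V → Set
Joins a b u v = (a ≡ u × b ≡ v) ⊎ (a ≡ v × b ≡ u)

record Edges {V : Set} (G : Graph V) (t : ℕ) : Set where
  field
    end₁ end₂ : Fin t → V
    isEdge    : ∀ i → Adj G (end₁ i) (end₂ i)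
    distinct  : ∀ {i j} → Joins (end₁ i) (end₂ i) (end₁ j) (end₂ j) → i ≡ j

-- Subdivide each of the t chosen edges once; inj₂ i is the new vertex placed
-- on the i-th of them.

module _ {n t : ℕ} (G : Graph (Fin n)) (E : Edges G t) where
  open Edges E

  SubdividedAdj : Fin n ⊎ Fin t → Fin n ⊎ Fin t → Set
  SubdividedAdj (inj₁ u) (inj₁ v) = Adj G u v × (∀ i → ¬ Joins (end₁ i) (end₂ i) u v)
  SubdividedAdj (inj₁ u) (inj₂ i) = u ≡ end₁ i ⊎ u ≡ end₂ i
  SubdividedAdj (inj₂ i) (inj₁ u) = u ≡ end₁ i ⊎ u ≡ end₂ i
  SubdividedAdj (inj₂ i) (inj₂ j) = ⊥

  subdivide : Graph (Fin n ⊎ Fin t)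
  subdivide = record { Adj = SubdividedAdj ; adj? = dec ; adj-sym = symm ; irrefl = irr }
    where
    dec : ∀ x y → Dec (SubdividedAdj x y)
    dec (inj₁ u) (inj₁ v) = adj? G u v ×-dec all? λ i →
      ¬? (((end₁ i ≟ u) ×-dec (end₂ i ≟ v)) ⊎-dec ((end₁ i ≟ v) ×-dec (end₂ i ≟ u)))
    dec (inj₁ u) (inj₂ i) = (u ≟ end₁ i) ⊎-dec (u ≟ end₂ i)
    dec (inj₂ i) (inj₁ u) = (u ≟ end₁ i) ⊎-dec (u ≟ end₂ i)
    dec (inj₂ i) (inj₂ j) = no id

    symm : ∀ {x y} → SubdividedAdj x y → SubdividedAdj y x
    symm {inj₁ u} {inj₁ v} (e , new) = adj-sym G e , λ i → new i ∘ swap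
    symm {inj₁ u} {inj₂ i} e = e
    symm {inj₂ i} {inj₁ u} e = e

    irr : ∀ {x} → ¬ SubdividedAdj x x
    irr {inj₁ u} (e , _) = irrefl G e

IsSpider : {V : Set} → ℕ → Graph V → Set₁
IsSpider t T =
  ∃[ m ] Σ[ S ∈ Graph (Fin m) ] (IsStar S × (Σ[ E ∈ Edges S t ] T ≅ subdivide S E))

module _ {n : ℕ} (G : Graph (Fin n)) where

  N : Fin n → Subset n
  N v = tabulate (λ u → does (adj? G v u))

  N[_] : Fin n → Subset n
  N[ v ] = ⁅ v ⁆ ∪ N v

  degree : Fin n → ℕ
  degree v = ∣ N v ∣

  Δ : ℕ
  Δ = max 0 (map degree (allFin n))

  LimitedPacking : ℕ → Subset n → Set
  LimitedPacking k B = ∀ v → ∣ N[ v ] ∩ B ∣ ≤ k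

  limitedPacking? : ∀ k B → Dec (LimitedPacking k B)
  limitedPacking? k B = all? (λ v → ∣ N[ v ] ∩ B ∣ ≤? k)

allSubsets : ∀ n → List (Subset n)
allSubsets zero    = [ [] ]
allSubsets (suc n) = map (outside ∷_) (allSubsets n) ++ map (inside ∷_) (allSubsets n)

-- The default value 0 of max is harmless: the empty set is always a packing.

L : ∀ {n} → ℕ → Graph (Fin n) → ℕ
L {n} k G = max 0 (map ∣_∣ (filter (limitedPacking? G k) (allSubsets n)))

∈-allSubsets : ∀ {n} (B : Subset n) → B ∈ allSubsets n
∈-allSubsets []          = here refl
∈-allSubsets (false ∷ B) = ∈-++⁺ˡ (∈-map⁺ (outside ∷_) (∈-allSubsets B))
∈-allSubsets {suc n} (true ∷ B) =
  ∈-++⁺ʳ (map (outside ∷_) (allSubsets n)) (∈-map⁺ (inside ∷_) (∈-allSubsets B))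

L-upper : ∀ {n} k (G : Graph (Fin n)) B → LimitedPacking G k B → ∣ B ∣ ≤ L k G
L-upper k G B pB =
  lookup (xs≤max 0 _) (∈-map⁺ ∣_∣ (∈-filter⁺ (limitedPacking? G k) (∈-allSubsets B) pB))

L-attained : ∀ {n} k (G : Graph (Fin n)) → ∃[ B ] (LimitedPacking G k B × ∣ B ∣ ≡ L k G)
L-attained {n} k G
  with argmax-sel id 0 (map ∣_∣ (filter (limitedPacking? G k) (allSubsets n)))
... | inj₁ L≡0 = Subset.⊥ , ∅-packing , subst (∣ Subset.⊥ {n} ∣ ≡_) (sym L≡0) (∣⊥∣≡0 n)
  where
  ∅-packing : LimitedPacking G k Subset.⊥
  ∅-packing v = ≤-trans (p⊆q⇒∣p∣≤∣q∣ (p∩q⊆q (N[_] G v) Subset.⊥))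
                        (≤-trans (≤-reflexive (∣⊥∣≡0 n)) z≤n)
... | inj₂ L∈
  with B , B∈ , L≡∣B∣ ← ∈-map⁻ ∣_∣ L∈
  with _ , pB ← ∈-filter⁻ (limitedPacking? G k) {xs = allSubsets n} B∈
  = B , pB , sym L≡∣B∣

{-# OPTIONS --safe #-}
module Submission where

-- Root the tree.  If z is a deepest vertex of a set X, the vertices of X that share a closed
-- neighbourhood with z all lie in N[parent z].  Applied greedily to a 2-limited packing this
-- extracts a 1-limited packing of at least half its size, and it gives the Helly property of
-- closed neighbourhoods.  Adding any vertex to a maximum 1-limited packing B gives a 2-limited
-- packing, hence L₁ + 1 ≤ L₂.  In case of equality no two vertices can be added, so the vertices
-- outside B pairwise share closed neighbourhoods and lie in a single N[c]; every other vertex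
-- is in B and is a leaf at distance two from c, which is a spider.  Conversely, the closed
-- neighbourhood of the centre together with the t far ends bounds L₂ by t + 2, and the far ends
-- with an unsubdivided leaf form a 1-limited packing of size t + 1.

open import Defs
open import Data.Bool.Base using (true; false)
open import Data.Nat.Base using (ℕ; zero; suc; _+_; _*_; _≤_; _<_; z≤n; s≤s; s≤s⁻¹)
open import Data.Nat.Properties
  using (≤-refl; ≤-trans; ≤-reflexive; ≤-antisym; <⇒≱; 1+n≰n; +-comm; +-suc; +-monoˡ-≤;
    *-monoʳ-≤; *-distribˡ-+; +-mono-≤; m≤m+n; suc-injective; ≤-total; n≤1+n; ≤∧≢⇒<;
    module ≤-Reasoning)
open import Data.Fin.Base using (Fin; zero; suc; splitAt; join)
open import Data.Fin.Properties as Finₚ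
  using (_≟_; any?; all?; injective⇒≤; join-splitAt; splitAt-join)
open import Data.Fin.Subset using (Subset; _∈_; _∉_; _⊆_; _∪_; _∩_; ⁅_⁆; ∣_∣; ∁)
open import Data.Fin.Subset.Properties
  using (_∈?_; x∈⁅x⁆; x∈∁p⇒x∉p; x∉p⇒x∈∁p; x∈⁅y⁆⇒x≡y; x∈p∪q⁺; x∈p∪q⁻; x∈p∩q⁺; x∈p∩q⁻; p⊆p∪q;
    p⊆q⇒∣p∣≤∣q∣; ∣p∩q∣≤∣q∣; q⊆p∪q)
open import Data.Vec.Base using ([]; _∷_; tabulate; here; there)
open import Data.Vec.Properties using ([]=⇒lookup; lookup⇒[]=; lookup∘tabulate)
open import Data.Product.Base using (Σ-syntax; ∃; ∃-syntax; _×_; _,_; proj₁; proj₂)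
open import Data.Unit.Base using (⊤; tt)
open import Data.List.Base using (map; allFin)
open import Data.List.Extrema.Nat using (xs≤max; argmax-sel)
open import Data.List.Membership.Propositional.Properties using (∈-map⁺; ∈-map⁻; ∈-allFin)
open import Data.List.Relation.Unary.All as All using (All; []; _∷_)
open import Data.List.Relation.Unary.AllPairs using ([]; _∷_)
open import Data.Sum.Base using (_⊎_; inj₁; inj₂; [_,_]′; swap)
open import Data.Sum.Properties using (inj₁-injective; inj₂-injective)
open import Data.Empty using (⊥-elim)
open import Function.Base using (_∘_; id)
open import Function.Bundles using (_↔_; _⇔_; Inverse; mk⇔; mk↔ₛ′; Equivalence)
open import Function.Definitions using (Injective)
open import Relation.Binary.PropositionalEquality
  using (_≡_; _≢_; refl; sym; trans; cong; subst; subst₂)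
open import Relation.Nullary using (¬_; Dec; yes; no; does; contradiction)
open import Relation.Nullary.Decidable using (dec-true; ¬?; _×-dec_; _⊎-dec_; decidable-stable)
open import Relation.Unary using (Pred; Decidable)
open import Level using (0ℓ)

private variable
  n k : ℕ
  x y : Fin n

-- Counting subsets

enumerate : (B : Subset n) → Fin ∣ B ∣ → Fin n
enumerate (true  ∷ B) zero    = zero
enumerate (true  ∷ B) (suc i) = suc (enumerate B i)
enumerate (false ∷ B) i       = suc (enumerate B i)

enumerate-∈ : (B : Subset n) → ∀ i → enumerate B i ∈ B
enumerate-∈ (true  ∷ B) zero    = here
enumerate-∈ (true  ∷ B) (suc i) = there (enumerate-∈ B i)
enumerate-∈ (false ∷ B) i       = there (enumerate-∈ B i)

index : {B : Subset n} → x ∈ B → Fin ∣ B ∣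
index {B = true  ∷ B} here      = zero
index {B = true  ∷ B} (there p) = suc (index p)
index {B = false ∷ B} (there p) = index p

enumerate-index : {B : Subset n} (p : x ∈ B) → enumerate B (index p) ≡ x
enumerate-index {B = true  ∷ B} here      = refl
enumerate-index {B = true  ∷ B} (there p) = cong suc (enumerate-index p)
enumerate-index {B = false ∷ B} (there p) = cong suc (enumerate-index p)

enumerate-injective : (B : Subset n) → Injective _≡_ _≡_ (enumerate B)
enumerate-injective (true  ∷ B) {zero}  {zero}  eq = refl
enumerate-injective (true  ∷ B) {suc i} {suc j} eq = cong suc (enumerate-injective B (Finₚ.suc-injective eq))
enumerate-injective (false ∷ B) eq = enumerate-injective B (Finₚ.suc-injective eq)

index-injective : {B : Subset n} (p : x ∈ B) (q : y ∈ B) → index p ≡ index q → x ≡ y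
index-injective {B = B} p q eq =
  trans (sym (enumerate-index p)) (trans (cong (enumerate B) eq) (enumerate-index q))

∣∣≥-injection : {B : Subset n} (h : Fin k → Fin n) → Injective _≡_ _≡_ h →
                (∀ i → h i ∈ B) → k ≤ ∣ B ∣
∣∣≥-injection h h-inj h∈ = injective⇒≤ λ eq → h-inj (index-injective (h∈ _) (h∈ _) eq)

∣∣≥-disjoint : {A B : Subset n} (h : Fin k → Fin n) → Injective _≡_ _≡_ h → A ⊆ B →
               (∀ i → h i ∈ B) → (∀ i → h i ∉ A) → ∣ A ∣ + k ≤ ∣ B ∣
∣∣≥-disjoint {n} {k} {A} {B} h h-inj A⊆B h∈ h∉ =
  ∣∣≥-injection (g ∘ splitAt ∣ A ∣) inj (λ i → g∈ (splitAt ∣ A ∣ i))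
  where
  g : Fin ∣ A ∣ ⊎ Fin k → Fin n
  g = [ enumerate A , h ]′
  g∈ : ∀ s → g s ∈ B
  g∈ (inj₁ i) = A⊆B (enumerate-∈ A i)
  g∈ (inj₂ i) = h∈ i
  g-inj : ∀ s t → g s ≡ g t → s ≡ t
  g-inj (inj₁ i) (inj₁ j) eq = cong inj₁ (enumerate-injective A eq)
  g-inj (inj₁ i) (inj₂ j) eq = contradiction (subst (_∈ A) eq (enumerate-∈ A i)) (h∉ j)
  g-inj (inj₂ i) (inj₁ j) eq = contradiction (subst (_∈ A) (sym eq) (enumerate-∈ A j)) (h∉ i)
  g-inj (inj₂ i) (inj₂ j) eq = cong inj₂ (h-inj eq)
  inj : Injective _≡_ _≡_ (g ∘ splitAt ∣ A ∣)
  inj {i} {j} eq = trans (sym (join-splitAt ∣ A ∣ k i))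
    (trans (cong (join ∣ A ∣ k) (g-inj (splitAt ∣ A ∣ i) (splitAt ∣ A ∣ j) eq))
           (join-splitAt ∣ A ∣ k j))

-- Each element of `B` is coded by whichever case `cover` returns for it, so overlaps between `A`
-- and the range of `h`, or repetitions in `h`, do no harm.
∣∣≤-cover : {A B : Subset n} (h : Fin k → Fin n) →
            (∀ {x} → x ∈ B → x ∈ A ⊎ ∃[ i ] x ≡ h i) → ∣ B ∣ ≤ ∣ A ∣ + k
∣∣≤-cover {n} {k} {A} {B} h cover = injective⇒≤ inj
  where
  C : Fin n → Set
  C x = x ∈ A ⊎ ∃[ i ] x ≡ h i
  code : ∀ {x} → C x → Fin ∣ A ∣ ⊎ Fin k
  code (inj₁ x∈A)     = inj₁ (index x∈A)
  code (inj₂ (i , _)) = inj₂ i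
  code-inj : ∀ {x y} (c : C x) (d : C y) → code c ≡ code d → x ≡ y
  code-inj (inj₁ p) (inj₁ q) eq = index-injective p q (inj₁-injective eq)
  code-inj (inj₂ (i , refl)) (inj₂ (j , refl)) eq = cong h (inj₂-injective eq)
  f : Fin ∣ B ∣ → Fin (∣ A ∣ + k)
  f i = join ∣ A ∣ k (code (cover (enumerate-∈ B i)))
  inj : Injective _≡_ _≡_ f
  inj {i} {j} eq = enumerate-injective B (code-inj (cover (enumerate-∈ B i)) (cover (enumerate-∈ B j))
    (trans (sym (splitAt-join ∣ A ∣ k _)) (trans (cong (splitAt ∣ A ∣) eq) (splitAt-join ∣ A ∣ k _))))

∣∣≤-image : {B : Subset n} (h : Fin k → Fin n) → (∀ {x} → x ∈ B → ∃[ i ] x ≡ h i) → ∣ B ∣ ≤ k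
∣∣≤-image {B = B} h cover = injective⇒≤ {f = λ i → proj₁ (cover (enumerate-∈ B i))} λ {i} {j} eq →
  enumerate-injective B (trans (proj₂ (cover (enumerate-∈ B i)))
    (trans (cong h eq) (sym (proj₂ (cover (enumerate-∈ B j))))))

pair : Fin n → Fin n → Fin 2 → Fin n
pair x y zero    = x
pair x y (suc _) = y

pair-injective : x ≢ y → Injective _≡_ _≡_ (pair x y)
pair-injective x≢y {zero}     {zero}     eq = refl
pair-injective x≢y {zero}     {suc zero} eq = contradiction eq x≢y
pair-injective x≢y {suc zero} {zero}     eq = contradiction (sym eq) x≢y
pair-injective x≢y {suc zero} {suc zero} eq = refl

∣∣≤1⇒≡ : {B : Subset n} → ∣ B ∣ ≤ 1 → x ∈ B → y ∈ B → x ≡ y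
∣∣≤1⇒≡ {x = x} {y = y} ∣B∣≤1 x∈B y∈B with x ≟ y
... | yes x≡y = x≡y
... | no  x≢y = contradiction ∣B∣≤1 (<⇒≱ (∣∣≥-injection (pair x y) (pair-injective x≢y) pair∈))
  where
  pair∈ : ∀ i → pair x y i ∈ _
  pair∈ zero    = x∈B
  pair∈ (suc _) = y∈B

≡⇒∣∣≤1 : {B : Subset n} → (∀ {x y} → x ∈ B → y ∈ B → x ≡ y) → ∣ B ∣ ≤ 1
≡⇒∣∣≤1 {B = B} eq = injective⇒≤ {f = λ _ → zero} λ {i} {j} _ →
  enumerate-injective B (eq (enumerate-∈ B i) (enumerate-∈ B j))

-- Subsets cut out by decidable predicates, and extremal choices.

select : {P : Pred (Fin n) 0ℓ} → Decidable P → Subset n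
select P? = tabulate (does ∘ P?)

∈-select⁺ : {P : Pred (Fin n) 0ℓ} (P? : Decidable P) → P x → x ∈ select P?
∈-select⁺ {x = x} P? px =
  lookup⇒[]= x _ (trans (lookup∘tabulate (does ∘ P?) x) (dec-true (P? x) px))

∈-select⁻ : {P : Pred (Fin n) 0ℓ} (P? : Decidable P) → x ∈ select P? → P x
∈-select⁻ {x = x} P? x∈ with P? x | trans (sym (lookup∘tabulate (does ∘ P?) x)) ([]=⇒lookup x∈)
... | yes px | _ = px

argmaxOn : (d : Fin n → ℕ) {P : Pred (Fin n) 0ℓ} → Decidable P → ∃ P →
           ∃[ z ] (P z × ∀ {x} → P x → d x ≤ d z)
argmaxOn {suc n} d {P} P? (w , pw) with any? (P? ∘ suc)
argmaxOn {suc n} d {P} P? (zero , pw) | no ¬∃ =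
  zero , pw , λ { {zero} _ → ≤-refl ; {suc x} px → contradiction (x , px) ¬∃ }
argmaxOn {suc n} d {P} P? (suc w , pw) | no ¬∃ = contradiction (w , pw) ¬∃
... | yes ∃P with argmaxOn (d ∘ suc) (P? ∘ suc) ∃P | P? zero
... | z , pz , z-max | no ¬p0 =
  suc z , pz , λ { {zero} p0 → contradiction p0 ¬p0 ; {suc x} px → z-max px }
... | z , pz , z-max | yes p0 with ≤-total (d zero) (d (suc z))
... | inj₁ d0≤dz = suc z , pz , λ { {zero} _ → d0≤dz ; {suc x} px → z-max px }
... | inj₂ dz≤d0 = zero , p0 , λ { {zero} _ → ≤-refl ; {suc x} px → ≤-trans (z-max px) dz≤d0 }

-- The search runs upwards from 0, bounded by the known witness `m`.
least : {P : ℕ → Set} → (∀ k → Dec (P k)) → ∀ {m} → P m → ∃[ k ] (P k × (∀ {j} → P j → k ≤ j))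
least P? {m} pm with P? zero
... | yes p0 = zero , p0 , λ _ → z≤n
least P? {zero}  p0 | no ¬p0 = contradiction p0 ¬p0
least P? {suc m} pm | no ¬p0 with k , pk , min ← least (P? ∘ suc) pm =
  suc k , pk , λ { {zero} p0 → contradiction p0 ¬p0 ; {suc j} pj → s≤s (min pj) }

-- Trees and rooted trees

-- The relation that `x` lies in the closed neighbourhood of `v`, in a form that can be matched on.
Near : (T : Graph (Fin n)) → Fin n → Fin n → Set
Near T v x = x ≡ v ⊎ Adj T v x

module _ (T : Graph (Fin n)) where

  near⇒∈ : ∀ {v} → Near T v x → x ∈ N[_] T v
  near⇒∈ {v = v} (inj₁ refl) = x∈p∪q⁺ (inj₁ (x∈⁅x⁆ v))
  near⇒∈ {v = v} (inj₂ vx)   = x∈p∪q⁺ (inj₂ (∈-select⁺ (adj? T v) vx))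

  ∈⇒near : ∀ {v} → x ∈ N[_] T v → Near T v x
  ∈⇒near {v = v} x∈ with x∈p∪q⁻ ⁅ v ⁆ (N T v) x∈
  ... | inj₁ x∈v = inj₁ (x∈⁅y⁆⇒x≡y v x∈v)
  ... | inj₂ x∈N = inj₂ (∈-select⁻ (adj? T v) x∈N)

  near? : ∀ v x → Dec (Near T v x)
  near? v x = (x ≟ v) ⊎-dec adj? T v x

  adj⇒≢ : ∀ {u v} → Adj T u v → u ≢ v
  adj⇒≢ uv refl = irrefl T uv

  walk? : ∀ ℓ u v → Dec (Walk T u v ℓ)
  walk? zero u v with u ≟ v
  ... | yes refl = yes nil
  ... | no  u≢v  = no λ { nil → u≢v refl }
  walk? (suc ℓ) u v with any? (λ w → adj? T u w ×-dec walk? ℓ w v)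
  ... | yes (_ , e , w) = yes (cons e w)
  ... | no  ¬∃          = no λ { (cons e w) → ¬∃ (_ , e , w) }

  distance : Connected T → ∀ u v → ∃[ d ] HasDistance T u v d
  distance conn u v = least (λ ℓ → walk? ℓ u v) (proj₂ (conn u v))

  neighbour : Connected T → x ≢ y → ∃[ z ] Adj T x z
  neighbour {x = x} {y = y} conn x≢y with conn x y
  ... | _ , nil      = contradiction refl x≢y
  ... | _ , cons e _ = _ , e

module _ {T : Graph (Fin n)} where

  snoc : ∀ {u v w ℓ} → Walk T u v ℓ → Adj T v w → Walk T u w (suc ℓ)
  snoc nil        e′ = cons e′ nil
  snoc (cons e p) e′ = cons e (snoc p e′)

  All-snoc : ∀ {P : Fin n → Set} {u v w ℓ} (p : Walk T u v ℓ) (e : Adj T v w) →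
             All P (vertices p) → P w → All P (vertices (snoc p e))
  All-snoc nil        _  (pv ∷ [])  pw = pv ∷ pw ∷ []
  All-snoc (cons _ p) e′ (pu ∷ all) pw = pu ∷ All-snoc p e′ all pw

  IsPath-snoc : ∀ {u v w ℓ} (p : Walk T u v ℓ) (e : Adj T v w) →
                IsPath p → All (_≢ w) (vertices p) → IsPath (snoc p e)
  IsPath-snoc nil        e  _ (v≢w ∷ []) = (v≢w ∷ []) ∷ [] ∷ []
  IsPath-snoc (cons _ p) e′ (u∉ ∷ path) (u≢w ∷ ∉w) =
    All-snoc p e′ u∉ u≢w ∷ IsPath-snoc p e′ path ∉w

module Acyclic (T : Graph (Fin n)) (acyclic : ¬ Cycle T) where

  no-triangle : ∀ {u v w} → Adj T u v → Adj T v w → ¬ Adj T w u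
  no-triangle uv vw wu = acyclic record
    { walk    = cons uv (cons vw nil)
    ; isPath  = (adj⇒≢ T uv ∷ adj⇒≢ T (adj-sym T wu) ∷ []) ∷ (adj⇒≢ T vw ∷ []) ∷ [] ∷ []
    ; 2≤len   = s≤s (s≤s z≤n)
    ; closing = wu }

  no-square : ∀ {u v x y} → u ≢ v → x ≢ y → Adj T u x → Adj T x v → Adj T v y → ¬ Adj T y u
  no-square u≢v x≢y ux xv vy yu = acyclic record
    { walk    = cons ux (cons xv (cons vy nil))
    ; isPath  = (adj⇒≢ T ux ∷ u≢v ∷ adj⇒≢ T (adj-sym T yu) ∷ [])
              ∷ (adj⇒≢ T xv ∷ x≢y ∷ []) ∷ (adj⇒≢ T vy ∷ []) ∷ [] ∷ []
    ; 2≤len   = s≤s (s≤s z≤n)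
    ; closing = yu }

  -- Only `N[c]` contains two distinct neighbours of `c`: if `v` were one of the two there would be
  -- a triangle, and any other `v` would give a square.
  common-near : ∀ {c v} → x ≢ y → Adj T c x → Adj T c y → Near T v x → Near T v y → v ≡ c
  common-near x≢y cx cy (inj₁ refl) (inj₁ refl) = contradiction refl x≢y
  common-near x≢y cx cy (inj₁ refl) (inj₂ xy)   = contradiction (adj-sym T cy) (no-triangle cx xy)
  common-near x≢y cx cy (inj₂ yx)   (inj₁ refl) = contradiction (adj-sym T cx) (no-triangle cy yx)
  common-near {c = c} {v} x≢y cx cy (inj₂ vx) (inj₂ vy) with v ≟ c
  ... | yes v≡c = v≡c
  ... | no  v≢c = contradiction (adj-sym T cy) (no-square (v≢c ∘ sym) x≢y cx (adj-sym T vx) vy)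

-- `parent-near` allows the root to be its own parent. Acyclicity enters through `edge`: every edge
-- joins a vertex to its parent, exactly one level apart.
record Rooted (T : Graph (Fin n)) : Set where
  field
    depth       : Fin n → ℕ
    parent      : Fin n → Fin n
    parent-near : ∀ v → Near T (parent v) v
    edge        : ∀ {u v} → Adj T u v → (depth u ≡ suc (depth v) × parent u ≡ v)
                                       ⊎ (depth v ≡ suc (depth u) × parent v ≡ u)

  -- The vertices sharing a closed neighbourhood with z and at most as deep as z all lie
  -- in one closed neighbourhood: in the square of the tree, z is simplicial among them.
  shallow-near-parent : ∀ {v x z} → depth x ≤ depth z → Near T v x → Near T v z →
                        Near T (parent z) x
  shallow-near-parent {z = z} dx≤dz vx (inj₁ refl) with vx
  ... | inj₁ refl = parent-near z
  ... | inj₂ zx with edge zx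
  ... | inj₁ (_ , pz≡x)  = inj₁ (sym pz≡x)
  ... | inj₂ (dx≡ , _)   = contradiction dx≤dz (<⇒≱ (≤-reflexive (sym dx≡)))
  shallow-near-parent {z = z} dx≤dz vx (inj₂ vz) with edge vz
  ... | inj₂ (_ , refl) = vx
  ... | inj₁ (dv≡ , pv≡z) with vx
  ... | inj₁ refl = contradiction dx≤dz (<⇒≱ (≤-reflexive (sym dv≡)))
  ... | inj₂ vx′ with edge vx′
  ... | inj₁ (_ , pv≡x) = subst (Near T (parent z)) (trans (sym pv≡z) pv≡x) (parent-near z)
  ... | inj₂ (dx≡ , _)  =
    contradiction dx≤dz
      (<⇒≱ (≤-trans (≤-reflexive (sym dv≡)) (≤-trans (n≤1+n _) (≤-reflexive (sym dx≡)))))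

  -- Every vertex satisfying `P` shares a closed neighbourhood with a deepest one `z` and is no
  -- deeper than `z`, so the parent of `z` serves for all of them.
  helly : {P : Pred (Fin n) 0ℓ} → Decidable P → ∃ P →
          (∀ {x y} → P x → P y → ∃[ v ] (Near T v x × Near T v y)) →
          ∃[ c ] (∀ {x} → P x → Near T c x)
  helly P? ∃P pairwise with z , pz , deepest ← argmaxOn depth P? ∃P =
    parent z , λ px → let _ , vx , vz = pairwise px pz in shallow-near-parent (deepest px) vx vz

-- Rooting a tree at `r` by distance.

module _ {T : Graph (Fin n)} (r : Fin n) (isTree : IsTree T) where
  open IsTree isTree

  private
    dist : ∀ v → ∃[ d ] HasDistance T v r d
    dist v = distance T connected v r

    depth : Fin n → ℕ
    depth v = proj₁ (dist v)

    depth-min : ∀ {v ℓ} → Walk T v r ℓ → depth v ≤ ℓ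
    depth-min {v} = proj₂ (proj₂ (dist v))

    -- The second vertex of the walk; the value for the empty walk makes the root its own parent.
    next : ∀ {v ℓ} → Walk T v r ℓ → Fin n
    next nil                = r
    next (cons {v = w} _ _) = w

    parent : Fin n → Fin n
    parent v = next (proj₁ (proj₂ (dist v)))

    Climb : Fin n → Set
    Climb v = (depth v ≡ 0 × v ≡ r × parent v ≡ r)
            ⊎ (depth v ≡ suc (depth (parent v)) × Adj T v (parent v))

    climb : ∀ v → Climb v
    climb v with dist v
    ... | _ , nil , _ = inj₁ (refl , refl , refl)
    ... | suc ℓ , cons {v = w} e p , min = inj₂ (≤-antisym
      (min (cons e (proj₁ (proj₂ (dist w))))) (s≤s (depth-min p)) , e)

    depth-adj : ∀ {u v} → Adj T u v → depth u ≤ suc (depth v)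
    depth-adj {v = v} e = depth-min (cons e (proj₁ (proj₂ (dist v))))

    -- A path that closes to a cycle as soon as its ends are adjacent, or have a common neighbour
    -- deeper than `k`.
    record LowPath (k : ℕ) (u v : Fin n) : Set where
      field
        {len}  : ℕ
        walk   : Walk T u v len
        isPath : IsPath walk
        2≤len  : 2 ≤ len
        low    : All (λ x → depth x ≤ k) (vertices walk)

    -- Climb from both ends at once until the parents coincide. The inner path stays one level below
    -- the bound, so the new ends do not recur on it.
    lowPath : ∀ k {u v} → depth u ≡ k → depth v ≡ k → u ≢ v → LowPath k u v
    lowPath k {u} {v} du dv u≢v with climb u | climb v
    ... | inj₁ (_ , refl , _) | inj₁ (_ , refl , _) = contradiction refl u≢v
    ... | inj₁ (d0 , _) | inj₂ (d1 , _) with () ← trans (sym d0) (trans du (trans (sym dv) d1))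
    ... | inj₂ (d1 , _) | inj₁ (d0 , _) with () ← trans (sym d0) (trans dv (trans (sym du) d1))
    lowPath zero du dv u≢v | inj₂ (d1 , _) | inj₂ _ with () ← trans (sym du) d1
    lowPath (suc k) {u} {v} du dv u≢v | inj₂ (du′ , eu) | inj₂ (dv′ , ev)
      with parent u ≟ parent v
    ... | yes eq = record
      { walk   = cons (subst (Adj T u) eq eu) (cons (adj-sym T ev) nil)
      ; isPath = (adj⇒≢ T (subst (Adj T u) eq eu) ∷ u≢v ∷ [])
               ∷ (adj⇒≢ T (adj-sym T ev) ∷ []) ∷ [] ∷ []
      ; 2≤len  = s≤s (s≤s z≤n)
      ; low    = ≤-reflexive du
               ∷ ≤-trans (≤-reflexive (suc-injective (trans (sym dv′) dv))) (n≤1+n k)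
               ∷ ≤-reflexive dv ∷ [] }
    ... | no neq = record
      { walk   = cons eu (snoc walk (adj-sym T ev))
      ; isPath = All-snoc walk (adj-sym T ev) (All.map (λ dx → deep du dx) low) u≢v
               ∷ IsPath-snoc walk (adj-sym T ev) isPath (All.map (λ dx → deep dv dx ∘ sym) low)
      ; 2≤len  = ≤-trans 2≤len (≤-trans (n≤1+n _) (n≤1+n _))
      ; low    = ≤-reflexive du ∷ All-snoc walk (adj-sym T ev)
                   (All.map (λ dx → ≤-trans dx (n≤1+n k)) low) (≤-reflexive dv) }
      where
      open LowPath (lowPath k (suc-injective (trans (sym du′) du)) (suc-injective (trans (sym dv′) dv)) neq)
      deep : ∀ {x y} → depth x ≡ suc k → depth y ≤ k → x ≢ y
      deep dx dy refl = 1+n≰n (subst (_≤ k) dx dy)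

    -- An edge within a level would close a low path to a cycle.
    same-level : ∀ {u v} → Adj T u v → depth u ≢ depth v
    same-level uv du≡dv = acyclic record
      { walk = walk ; isPath = isPath ; 2≤len = 2≤len ; closing = adj-sym T uv }
      where open LowPath (lowPath _ du≡dv refl (adj⇒≢ T uv))

    -- A low path between two lower neighbours of `v` avoids `v`, which would close it to a cycle.
    unique-lower : ∀ {u u′ v} → Adj T v u → Adj T v u′ →
                   depth v ≡ suc (depth u) → depth v ≡ suc (depth u′) → u ≡ u′
    unique-lower {u} {u′} {v} vu vu′ d d′ with u ≟ u′
    ... | yes eq = eq
    ... | no neq = contradiction record
      { walk    = cons vu walk
      ; isPath  = All.map (λ dx → λ { refl → 1+n≰n (subst (_≤ _) d dx) }) low ∷ isPath
      ; 2≤len   = ≤-trans 2≤len (n≤1+n _)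
      ; closing = adj-sym T vu′ } acyclic
      where open LowPath (lowPath _ refl (suc-injective (trans (sym d′) d)) neq)

    lower-parent : ∀ {u v} → Adj T u v → depth u ≡ suc (depth v) → parent u ≡ v
    lower-parent {u} uv d with climb u
    ... | inj₁ (d0 , _) with () ← trans (sym d0) d
    lower-parent {u} uv d | inj₂ (d′ , up) = unique-lower up uv d′ d

  rooted : Rooted T
  rooted = record
    { depth = depth ; parent = parent ; parent-near = near ; edge = edge }
    where
    near : ∀ v → Near T (parent v) v
    near v with climb v
    ... | inj₁ (_ , v≡r , pv≡r) = inj₁ (trans v≡r (sym pv≡r))
    ... | inj₂ (_ , e)          = inj₂ (adj-sym T e)
    edge : ∀ {u v} → Adj T u v → (depth u ≡ suc (depth v) × parent u ≡ v)
                                ⊎ (depth v ≡ suc (depth u) × parent v ≡ u)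
    -- Depths of adjacent vertices differ by at most one and, by `same-level`, are not equal.
    edge {u} {v} uv with ≤-total (depth u) (depth v)
    ... | inj₁ du≤dv = inj₂ (dv , lower-parent (adj-sym T uv) dv)
      where dv = ≤-antisym (depth-adj (adj-sym T uv)) (≤∧≢⇒< du≤dv (same-level uv))
    ... | inj₂ dv≤du = inj₁ (du , lower-parent uv du)
      where du = ≤-antisym (depth-adj uv) (≤∧≢⇒< dv≤du (same-level uv ∘ sym))

-- Limited packings

Fin1-unique : (i j : Fin 1) → i ≡ j
Fin1-unique zero zero = refl

injective-Fin1 : (h : Fin 1 → Fin n) → Injective _≡_ _≡_ h
injective-Fin1 h {i} {j} _ = Fin1-unique i j

module _ (T : Graph (Fin n)) where

  packing₁⇒≡ : ∀ {B} → LimitedPacking T 1 B → ∀ {v x y} →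
               Near T v x → Near T v y → x ∈ B → y ∈ B → x ≡ y
  packing₁⇒≡ pB {v} vx vy x∈B y∈B =
    ∣∣≤1⇒≡ (pB v) (x∈p∩q⁺ (near⇒∈ T vx , x∈B)) (x∈p∩q⁺ (near⇒∈ T vy , y∈B))

  ≡⇒packing₁ : ∀ {B} → (∀ {v x y} → Near T v x → Near T v y → x ∈ B → y ∈ B → x ≡ y) →
               LimitedPacking T 1 B
  ≡⇒packing₁ {B} eq v = ≡⇒∣∣≤1 λ x∈ y∈ →
    let x∈N , x∈B = x∈p∩q⁻ (N[_] T v) B x∈
        y∈N , y∈B = x∈p∩q⁻ (N[_] T v) B y∈
    in  eq (∈⇒near T x∈N) (∈⇒near T y∈N) x∈B y∈B

  packing-⊆ : ∀ {A B} → A ⊆ B → LimitedPacking T k B → LimitedPacking T k A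
  packing-⊆ {A = A} {B} A⊆B pB v = ≤-trans (p⊆q⇒∣p∣≤∣q∣ λ x∈ →
    let x∈N , x∈A = x∈p∩q⁻ (N[_] T v) A x∈ in x∈p∩q⁺ (x∈N , A⊆B x∈A)) (pB v)

  -- Both ends of an edge lie in one closed neighbourhood, so a 1-limited packing misses one of
  -- them; `x ≢ y` and connectedness supply an edge.
  missed-vertex : Connected T → {x y : Fin n} → x ≢ y → ∀ {B} → LimitedPacking T 1 B → ∃[ z ] z ∉ B
  missed-vertex conn {x} x≢y {B} pB with neighbour T conn x≢y
  ... | z , xz with x ∈? B | z ∈? B
  ... | no  x∉B | _       = x , x∉B
  ... | yes _   | no z∉B  = z , z∉B
  ... | yes x∈B | yes z∈B =
    contradiction (packing₁⇒≡ pB (inj₁ refl) (inj₂ xz) x∈B z∈B) (adj⇒≢ T xz)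

module _ {T : Graph (Fin n)} (R : Rooted T) where
  open Rooted R

  -- Greedy: take a deepest vertex z of B and discard the at most one other vertex of B
  -- that conflicts with it.
  halve : ∀ m {B} → ∣ B ∣ ≤ m → LimitedPacking T 2 B →
          ∃[ C ] (C ⊆ B × LimitedPacking T 1 C × ∣ B ∣ ≤ 2 * ∣ C ∣)
  halve m {B} ∣B∣≤m pB with any? (_∈? B)
  halve m {B} ∣B∣≤m pB | no ∅B =
    B , id , ≡⇒packing₁ T (λ _ _ x∈B → contradiction (_ , x∈B) ∅B) , m≤m+n ∣ B ∣ _
  -- `m` bounds the size of `B` to ensure termination; with bound 0 the set `B` is itself 1-limited.
  halve zero {B} ∣B∣≤0 pB | yes _ =
    B , id , (λ v → ≤-trans (∣p∩q∣≤∣q∣ (N[_] T v) B) (≤-trans ∣B∣≤0 z≤n)) , m≤m+n ∣ B ∣ _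
  halve (suc m) {B} ∣B∣≤m pB | yes ∃B with argmaxOn depth (_∈? B) ∃B
  ... | z , z∈B , deepest = extend (halve m ∣B′∣≤m (packing-⊆ T (proj₁ ∘ ∈-select⁻ B′?) pB))
    where
    B′? : Decidable λ x → x ∈ B × ¬ Near T (parent z) x
    B′? x = (x ∈? B) ×-dec ¬? (near? T (parent z) x)

    B′ : Subset n
    B′ = select B′?

    -- The vertices removed from `B`: at most two, because `B` is 2-limited, and `z` is among them.
    M : Subset n
    M = N[_] T (parent z) ∩ B

    ∣B′∣<∣B∣ : ∣ B′ ∣ + 1 ≤ ∣ B ∣
    ∣B′∣<∣B∣ = ∣∣≥-disjoint (λ _ → z) (injective-Fin1 _) (proj₁ ∘ ∈-select⁻ B′?)
      (λ _ → z∈B) (λ _ z∈B′ → proj₂ (∈-select⁻ B′? z∈B′) (parent-near z))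

    ∣B′∣≤m : ∣ B′ ∣ ≤ m
    ∣B′∣≤m = s≤s⁻¹ (≤-trans (≤-reflexive (+-comm 1 ∣ B′ ∣)) (≤-trans ∣B′∣<∣B∣ ∣B∣≤m))

    split : ∀ {x} → x ∈ B → x ∈ B′ ⊎ ∃[ i ] x ≡ enumerate M i
    split {x} x∈B with near? T (parent z) x
    ... | no far = inj₁ (∈-select⁺ B′? (x∈B , far))
    ... | yes nr = inj₂ (index x∈M , sym (enumerate-index x∈M))
      where
      x∈M : x ∈ M
      x∈M = x∈p∩q⁺ (near⇒∈ T nr , x∈B)

    extend : ∃[ C ] (C ⊆ B′ × LimitedPacking T 1 C × ∣ B′ ∣ ≤ 2 * ∣ C ∣) →
             ∃[ C ] (C ⊆ B × LimitedPacking T 1 C × ∣ B ∣ ≤ 2 * ∣ C ∣)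
    extend (C , C⊆B′ , pC , ∣B′∣≤) = C⁺ , C⁺⊆B , ≡⇒packing₁ T unique , ∣B∣≤
      where
      C⁺ : Subset n
      C⁺ = C ∪ ⁅ z ⁆
      split⁺ : ∀ {x} → x ∈ C⁺ → x ∈ C ⊎ x ≡ z
      split⁺ x∈ with x∈p∪q⁻ C ⁅ z ⁆ x∈
      ... | inj₁ x∈C = inj₁ x∈C
      ... | inj₂ x∈z = inj₂ (x∈⁅y⁆⇒x≡y z x∈z)
      C⊆B : C ⊆ B
      C⊆B x∈C = proj₁ (∈-select⁻ B′? (C⊆B′ x∈C))
      C⁺⊆B : C⁺ ⊆ B
      C⁺⊆B x∈ with split⁺ x∈
      ... | inj₁ x∈C  = C⊆B x∈C
      ... | inj₂ refl = z∈B
      -- A member of `C` sharing a closed neighbourhood with `z` would lie near the parent of `z`, a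
      -- region that `B′` avoids.
      apart : ∀ {v x} → Near T v x → Near T v z → x ∉ C
      apart vx vz x∈C = proj₂ (∈-select⁻ B′? (C⊆B′ x∈C))
        (shallow-near-parent (deepest (C⊆B x∈C)) vx vz)
      unique : ∀ {v x y} → Near T v x → Near T v y → x ∈ C⁺ → y ∈ C⁺ → x ≡ y
      unique vx vy x∈ y∈ with split⁺ x∈ | split⁺ y∈
      ... | inj₁ x∈C  | inj₁ y∈C  = packing₁⇒≡ T pC vx vy x∈C y∈C
      ... | inj₁ x∈C  | inj₂ refl = contradiction x∈C (apart vx vy)
      ... | inj₂ refl | inj₁ y∈C  = contradiction y∈C (apart vy vx)
      ... | inj₂ refl | inj₂ refl = refl
      -- The at most two vertices of `M` are paid for by the single new member `z`, counted twice.
      ∣B∣≤ : ∣ B ∣ ≤ 2 * ∣ C⁺ ∣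
      ∣B∣≤ = begin
        ∣ B ∣           ≤⟨ ∣∣≤-cover (enumerate M) split ⟩
        ∣ B′ ∣ + ∣ M ∣  ≤⟨ +-mono-≤ ∣B′∣≤ (pB (parent z)) ⟩
        2 * ∣ C ∣ + 2   ≡⟨ *-distribˡ-+ 2 ∣ C ∣ 1 ⟨
        2 * (∣ C ∣ + 1) ≤⟨ *-monoʳ-≤ 2 (∣∣≥-disjoint (λ _ → z) (injective-Fin1 _) (p⊆p∪q ⁅ z ⁆)
                             (λ _ → q⊆p∪q C ⁅ z ⁆ (x∈⁅x⁆ z)) (λ _ → apart (inj₁ refl) (inj₁ refl))) ⟩
        2 * ∣ C⁺ ∣      ∎
        where open ≤-Reasoning

  L₂≤2L₁ : L 2 T ≤ 2 * L 1 T
  L₂≤2L₁ with B , pB , ∣B∣≡L ← L-attained 2 T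
         with C , _ , pC , ∣B∣≤ ← halve ∣ B ∣ ≤-refl pB =
    ≤-trans (≤-reflexive (sym ∣B∣≡L)) (≤-trans ∣B∣≤ (*-monoʳ-≤ 2 (L-upper 1 T C pC)))

module _ (T : Graph (Fin n)) {B : Subset n} (h : Fin k → Fin n) where

  private
    B⁺? : Decidable λ x → x ∈ B ⊎ ∃[ i ] x ≡ h i
    B⁺? x = (x ∈? B) ⊎-dec any? (λ i → x ≟ h i)

  -- For each `v`, the family `g` collects the added vertices near `v`. Letting its length `j`
  -- depend on `v` means that only these count against the bound 2.
  augment : Injective _≡_ _≡_ h → (∀ i → h i ∉ B) →
            (∀ v → ∃[ j ] Σ[ g ∈ (Fin j → Fin n) ]
              (∣ N[_] T v ∩ B ∣ + j ≤ 2 × (∀ i → Near T v (h i) → ∃[ l ] h i ≡ g l))) →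
            ∣ B ∣ + k ≤ L 2 T
  augment h-inj h∉B small = ≤-trans
    (∣∣≥-disjoint h h-inj (λ x∈B → ∈-select⁺ B⁺? (inj₁ x∈B))
      (λ i → ∈-select⁺ B⁺? (inj₂ (i , refl))) h∉B)
    (L-upper 2 T (select B⁺?) packing)
    where
    packing : LimitedPacking T 2 (select B⁺?)
    packing v with j , g , bound , catch ← small v = ≤-trans (∣∣≤-cover g cover) bound
      where
      cover : ∀ {x} → x ∈ N[_] T v ∩ select B⁺? → x ∈ N[_] T v ∩ B ⊎ ∃[ l ] x ≡ g l
      cover x∈ with x∈N , x∈B⁺ ← x∈p∩q⁻ (N[_] T v) (select B⁺?) x∈ with ∈-select⁻ B⁺? x∈B⁺
      ... | inj₁ x∈B        = inj₁ (x∈p∩q⁺ (x∈N , x∈B))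
      ... | inj₂ (i , refl) = inj₂ (catch i (∈⇒near T x∈N))

module _ (T : Graph (Fin n)) {B : Subset n} (pB : LimitedPacking T 1 B) where

  -- Each closed neighbourhood holds at most one member of `B`, which leaves room for one more.
  L₂-one-more : ∀ {x} → x ∉ B → ∣ B ∣ + 1 ≤ L 2 T
  L₂-one-more {x = x} x∉B = augment T (λ (_ : Fin 1) → x) (injective-Fin1 _) (λ _ → x∉B)
    λ v → 1 , (λ _ → x) , +-monoˡ-≤ 1 (pB v) , λ _ _ → zero , refl

  -- A closed neighbourhood containing both new vertices misses `B` by the last hypothesis; every
  -- other one receives at most one new vertex.
  L₂-two-more : ∀ {x y} → x ≢ y → x ∉ B → y ∉ B →
                (∀ {v b} → Near T v x → Near T v y → Near T v b → b ∉ B) → ∣ B ∣ + 2 ≤ L 2 T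
  L₂-two-more {x = x} {y = y} x≢y x∉B y∉B free = augment T (pair x y) (pair-injective x≢y) ∉B small
    where
    ∉B : ∀ i → pair x y i ∉ B
    ∉B zero    = x∉B
    ∉B (suc _) = y∉B
    small : ∀ v → ∃[ j ] Σ[ g ∈ (Fin j → Fin n) ]
      (∣ N[_] T v ∩ B ∣ + j ≤ 2 × (∀ i → Near T v (pair x y i) → ∃[ l ] pair x y i ≡ g l))
    small v with near? T v x | near? T v y
    ... | no ¬vx | _ = 1 , (λ _ → y) , +-monoˡ-≤ 1 (pB v) ,
      λ { zero vx → contradiction vx ¬vx ; (suc _) _ → zero , refl }
    ... | yes _ | no ¬vy = 1 , (λ _ → x) , +-monoˡ-≤ 1 (pB v) ,
      λ { zero _ → zero , refl ; (suc _) vy → contradiction vy ¬vy }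
    ... | yes vx | yes vy = 2 , pair x y , +-monoˡ-≤ 2 empty , λ i _ → i , refl
      where
      empty : ∣ N[_] T v ∩ B ∣ ≤ 0
      empty = ∣∣≤-image {k = 0} (λ ()) λ b∈ →
        let b∈N , b∈B = x∈p∩q⁻ (N[_] T v) B b∈
        in  contradiction b∈B (free vx vy (∈⇒near T b∈N))

-- Spiders as subdivided stars

-- In particular, `index` does not depend on the membership proof.
index-cong : {B : Subset n} (p : x ∈ B) (q : y ∈ B) → x ≡ y → index p ≡ index q
index-cong {B = B} p q eq =
  enumerate-injective B (trans (enumerate-index p) (trans eq (sym (enumerate-index q))))

module _ (M : Subset n) where

  private
    to : ∀ {x} → Dec (x ∈ M) → Fin ∣ ∁ M ∣ ⊎ Fin ∣ M ∣
    to (yes x∈M) = inj₂ (index x∈M)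
    to (no  x∉M) = inj₁ (index (x∉p⇒x∈∁p x∉M))

    from : Fin ∣ ∁ M ∣ ⊎ Fin ∣ M ∣ → Fin n
    from = [ enumerate (∁ M) , enumerate M ]′

    to-from : ∀ s (d : Dec (from s ∈ M)) → to d ≡ s
    to-from (inj₁ i) (yes x∈M) = contradiction x∈M (x∈∁p⇒x∉p (enumerate-∈ (∁ M) i))
    to-from (inj₁ i) (no  x∉M) = cong inj₁ (enumerate-injective (∁ M) (enumerate-index _))
    to-from (inj₂ i) (yes x∈M) = cong inj₂ (enumerate-injective M (enumerate-index x∈M))
    to-from (inj₂ i) (no  x∉M) = contradiction (enumerate-∈ M i) x∉M

    from-to : ∀ {x} (d : Dec (x ∈ M)) → from (to d) ≡ x
    from-to (yes x∈M) = enumerate-index x∈M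
    from-to (no  x∉M) = enumerate-index (x∉p⇒x∈∁p x∉M)

  -- With `M` the set of subdivision vertices, the left summand carries the star and the right one
  -- the vertices placed on its edges.
  splitBy : Fin n ↔ (Fin ∣ ∁ M ∣ ⊎ Fin ∣ M ∣)
  splitBy = mk↔ₛ′ (λ x → to (x ∈? M)) from (λ s → to-from s (from s ∈? M)) (λ x → from-to (x ∈? M))

  splitBy-elim : ∀ {ℓ} (Q : Fin n → Fin ∣ ∁ M ∣ ⊎ Fin ∣ M ∣ → Set ℓ) →
    (∀ {x} (x∈ : x ∈ M) → Q x (inj₂ (index x∈))) →
    (∀ {x} (x∈ : x ∈ ∁ M) → Q x (inj₁ (index x∈))) →
    ∀ x → Q x (Inverse.to splitBy x)
  splitBy-elim Q q∈ q∉ x with x ∈? M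
  ... | yes x∈M = q∈ x∈M
  ... | no  x∉M = q∉ (x∉p⇒x∈∁p x∉M)

-- Stars with a given centre.

star : Fin n → Graph (Fin n)
star a = record
  { Adj     = λ u v → (u ≡ a × v ≢ a) ⊎ (v ≡ a × u ≢ a)
  ; adj?    = λ u v → ((u ≟ a) ×-dec ¬? (v ≟ a)) ⊎-dec ((v ≟ a) ×-dec ¬? (u ≟ a))
  ; adj-sym = swap
  ; irrefl  = λ { (inj₁ (v≡a , v≢a)) → v≢a v≡a ; (inj₂ (v≡a , v≢a)) → v≢a v≡a } }

module _ {a b : Fin n} (b≢a : b ≢ a) where

  private
    centre-leaf : ∀ {v} → v ≢ a → Adj (star a) a v
    centre-leaf v≢a = inj₁ (refl , v≢a)

    1-dist : ∀ {u v} → Adj (star a) u v → HasDistance (star a) u v 1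
    1-dist uv = cons uv nil , λ { nil → contradiction uv (irrefl (star a)) ; (cons _ _) → s≤s z≤n }

    2-dist : ∀ {u v} → u ≢ a → v ≢ a → u ≢ v → HasDistance (star a) u v 2
    2-dist u≢a v≢a u≢v =
      cons (swap (centre-leaf u≢a)) (cons (centre-leaf v≢a) nil) , λ where
        nil                             → contradiction refl u≢v
        (cons (inj₁ (u≡a , _)) nil)     → contradiction u≡a u≢a
        (cons (inj₂ (v≡a , _)) nil)     → contradiction v≡a v≢a
        (cons _ (cons _ _))             → s≤s (s≤s z≤n)

    -- Distance 2 comes with its two distinct leaves, so that it can be ruled out when there is only
    -- one leaf.
    star-distance : ∀ u v → ∃[ d ] (HasDistance (star a) u v d ×
                      (d ≤ 1 ⊎ (d ≡ 2 × u ≢ a × v ≢ a × u ≢ v)))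
    star-distance u v with u ≟ v | u ≟ a | v ≟ a
    ... | yes refl | _        | _        = 0 , (nil , λ _ → z≤n) , inj₁ z≤n
    ... | no  u≢v  | yes refl | _        = 1 , 1-dist (centre-leaf (u≢v ∘ sym)) , inj₁ ≤-refl
    ... | no  u≢v  | no u≢a   | yes refl = 1 , 1-dist (swap (centre-leaf u≢v)) , inj₁ ≤-refl
    ... | no  u≢v  | no u≢a   | no v≢a   = 2 , 2-dist u≢a v≢a u≢v , inj₂ (refl , u≢a , v≢a , u≢v)

    -- Walks alternate between centre and leaves. A cycle listed from the centre would return there
    -- after two steps, and one listed from a leaf would have the centre both second and last.
    star-acyclic : ¬ Cycle (star a)
    star-acyclic record { walk = nil ; 2≤len = () }
    star-acyclic record { walk = cons _ nil ; 2≤len = s≤s () }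
    star-acyclic record { walk = cons (inj₁ (refl , x≢a)) (cons (inj₁ (x≡a , _)) _) } = x≢a x≡a
    star-acyclic record { walk = cons (inj₁ (refl , _)) (cons (inj₂ (refl , _)) w)
                        ; isPath = (_ ∷ a∉w) ∷ _ } = head≢ w a∉w
      where
      head≢ : ∀ {u v ℓ} (w : Walk (star a) u v ℓ) → ¬ All (u ≢_) (vertices w)
      head≢ nil        (u≢u ∷ _) = u≢u refl
      head≢ (cons _ _) (u≢u ∷ _) = u≢u refl
    star-acyclic record { walk = cons (inj₂ (refl , u≢a)) w ; isPath = _ ∷ path
                        ; 2≤len = 2≤len ; closing = closing } with closing
    ... | inj₂ (u≡a , _) = u≢a u≡a
    ... | inj₁ (refl , _) = closed w (s≤s⁻¹ 2≤len) path
      where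
      last∈ : ∀ {u v x ℓ} (w : Walk (star a) u v ℓ) → All (x ≢_) (vertices w) → x ≢ v
      last∈ nil        (x≢v ∷ _) = x≢v
      last∈ (cons _ w) (_ ∷ x∉)  = last∈ w x∉
      closed : ∀ {u ℓ} (w : Walk (star a) u u ℓ) → 1 ≤ ℓ → ¬ IsPath w
      closed (cons _ w) _ (u∉ ∷ _) = last∈ w u∉ refl

  star-isStar : IsStar (star a)
  star-isStar = record
    { nontrivial = injective⇒≤ (pair-injective b≢a)
    ; isTree     = record
      { connected = λ u v → let d , (w , _) , _ = star-distance u v in d , w
      ; acyclic   = star-acyclic }
    ; diameter≤2 = diam }
    where
    diam : ∃[ d ] (HasDiameter (star a) d × d ≤ 2)
    -- The diameter must be exact: it is 2 if there is a leaf other than `b`, and 1 if the star is a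
    -- single edge.
    diam with any? (λ v → ¬? (v ≟ a) ×-dec ¬? (b ≟ v))
    ... | yes (v , v≢a , b≢v) = 2 , (bound , b , v , 2-dist b≢a v≢a b≢v) , ≤-refl
      where
      bound : ∀ u v → ∃[ e ] (HasDistance (star a) u v e × e ≤ 2)
      bound u v with star-distance u v
      ... | d , dist , inj₁ d≤1        = d , dist , ≤-trans d≤1 (s≤s z≤n)
      ... | d , dist , inj₂ (refl , _) = d , dist , ≤-refl
    ... | no ¬∃ = 1 , (bound , a , b , 1-dist (centre-leaf b≢a)) , s≤s z≤n
      where
      only-leaf : ∀ {v} → v ≢ a → b ≡ v
      only-leaf {v} v≢a = decidable-stable (b ≟ v) λ b≢v → ¬∃ (v , v≢a , b≢v)
      bound : ∀ u v → ∃[ e ] (HasDistance (star a) u v e × e ≤ 1)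
      bound u v with star-distance u v
      ... | d , dist , inj₁ d≤1                    = d , dist , d≤1
      ... | _ , _ , inj₂ (_ , u≢a , v≢a , u≢v) =
        contradiction (trans (sym (only-leaf u≢a)) (only-leaf v≢a)) u≢v

-- M is the set of subdivision vertices, foot m the end of the leg through m.
record SpiderShape (T : Graph (Fin n)) (c : Fin n) : Set where
  field
    M              : Subset n
    foot           : Fin n → Fin n
    adj-centre     : ∀ {m} → m ∈ M → Adj T m c
    adj-foot       : ∀ {m} → m ∈ M → Adj T m (foot m)
    adj-only       : ∀ {m x} → m ∈ M → Adj T m x → x ≡ c ⊎ x ≡ foot m
    foot-injective : ∀ {l m} → l ∈ M → m ∈ M → foot l ≡ foot m → l ≡ m
    foot≢c         : ∀ {m} → m ∈ M → foot m ≢ c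
    foot-far       : ∀ {m} → m ∈ M → ¬ Adj T c (foot m)
    centre-edge    : ∀ {u v} → u ∉ M → v ∉ M → Adj T u v → u ≡ c ⊎ v ≡ c
    short-leg      : ∀ {v} → v ∉ M → v ≢ c → (∀ {m} → m ∈ M → v ≢ foot m) → Adj T c v

  centre∉M : c ∉ M
  centre∉M c∈M = irrefl T (adj-centre c∈M)

  foot∉M : ∀ {m} → m ∈ M → foot m ∉ M
  foot∉M m∈M f∈M = foot-far m∈M (adj-sym T (adj-centre f∈M))

module _ {T : Graph (Fin n)} {c : Fin n} (shape : SpiderShape T c) where
  open SpiderShape shape

  private
    c∈∁M : c ∈ ∁ M
    c∈∁M = x∉p⇒x∈∁p centre∉M

    a : Fin ∣ ∁ M ∣
    a = index c∈∁M

    foot∈∁M : ∀ {m} → m ∈ M → foot m ∈ ∁ M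
    foot∈∁M m∈M = x∉p⇒x∈∁p (foot∉M m∈M)

    leg : Fin ∣ M ∣ → Fin ∣ ∁ M ∣
    leg i = index (foot∈∁M (enumerate-∈ M i))

    leg≢a : ∀ i → leg i ≢ a
    leg≢a i eq = foot≢c (enumerate-∈ M i) (index-injective _ c∈∁M eq)

    -- In the star each foot is a leaf at the centre, and its edge is the one subdivided by the
    -- corresponding vertex of `M`.
    legs : Edges (star a) ∣ M ∣
    legs = record
      { end₁     = λ _ → a
      ; end₂     = leg
      ; isEdge   = λ i → inj₁ (refl , leg≢a i)
      ; distinct = λ {i} {j} → λ where
          (inj₁ (_ , eq)) → enumerate-injective M
            (foot-injective (enumerate-∈ M i) (enumerate-∈ M j)
              (index-injective (foot∈∁M (enumerate-∈ M i)) (foot∈∁M (enumerate-∈ M j)) eq))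
          (inj₂ (a≡ , _)) → contradiction (sym a≡) (leg≢a _) }

    A : Fin ∣ ∁ M ∣ ⊎ Fin ∣ M ∣ → Fin ∣ ∁ M ∣ ⊎ Fin ∣ M ∣ → Set
    A = SubdividedAdj (star a) legs

    foot-index : ∀ {m} (m∈M : m ∈ M) → foot m ≡ foot (enumerate M (index m∈M))
    foot-index m∈M = cong foot (sym (enumerate-index m∈M))

    mid-mid : ∀ {u v} (u∈ : u ∈ M) (v∈ : v ∈ M) → Adj T u v ⇔ A (inj₂ (index u∈)) (inj₂ (index v∈))
    mid-mid u∈ v∈ = mk⇔ to λ ()
      where
      to : ¬ Adj T _ _
      to uv with adj-only u∈ uv
      ... | inj₁ refl = centre∉M v∈
      ... | inj₂ refl = foot∉M u∈ v∈

    mid-end : ∀ {u v} (u∈ : u ∈ M) (v∈ : v ∈ ∁ M) → Adj T u v ⇔ A (inj₂ (index u∈)) (inj₁ (index v∈))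
    mid-end {u} {v} u∈ v∈ = mk⇔ to from
      where
      to : Adj T u v → A (inj₂ (index u∈)) (inj₁ (index v∈))
      to uv with adj-only u∈ uv
      ... | inj₁ v≡c = inj₁ (index-cong v∈ c∈∁M v≡c)
      ... | inj₂ v≡f = inj₂
        (index-cong v∈ (foot∈∁M (enumerate-∈ M (index u∈))) (trans v≡f (foot-index u∈)))
      from : A (inj₂ (index u∈)) (inj₁ (index v∈)) → Adj T u v
      from (inj₁ eq) = subst (Adj T u) (sym (index-injective v∈ c∈∁M eq)) (adj-centre u∈)
      from (inj₂ eq) = subst (Adj T u)
        (trans (foot-index u∈) (sym (index-injective v∈ _ eq))) (adj-foot u∈)

    -- A neighbour of `c` is never a foot, so its edge in the star is not subdivided.
    centre-end : ∀ {v} (v∈ : v ∈ ∁ M) → Adj T c v → A (inj₁ a) (inj₁ (index v∈))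
    centre-end v∈ cv =
      inj₁ (refl , λ eq → adj⇒≢ T cv (sym (index-injective v∈ c∈∁M eq))) , λ where
        i (inj₁ (_ , eq)) → foot-far (enumerate-∈ M i)
          (subst (Adj T c) (sym (index-injective _ v∈ eq)) cv)
        i (inj₂ (_ , eq)) → leg≢a i eq

    end-centre : ∀ {v} (v∈ : v ∈ ∁ M) → index v∈ ≢ a →
                 (∀ i → ¬ Joins a (leg i) a (index v∈)) → Adj T c v
    end-centre {v} v∈ v≢a free = short-leg (x∈∁p⇒x∉p v∈) (v≢a ∘ index-cong v∈ c∈∁M)
      λ m∈M eq → free (index m∈M) (inj₁ (refl ,
        index-cong (foot∈∁M (enumerate-∈ M (index m∈M))) v∈ (sym (trans eq (foot-index m∈M)))))

    A-sym : ∀ s t → A s t → A t s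
    A-sym s t = adj-sym (subdivide (star a) legs) {s} {t}

    end-end : ∀ {u v} (u∈ : u ∈ ∁ M) (v∈ : v ∈ ∁ M) → Adj T u v ⇔ A (inj₁ (index u∈)) (inj₁ (index v∈))
    end-end {u} {v} u∈ v∈ = mk⇔ to from
      where
      to : Adj T u v → A (inj₁ (index u∈)) (inj₁ (index v∈))
      to uv with centre-edge (x∈∁p⇒x∉p u∈) (x∈∁p⇒x∉p v∈) uv
      ... | inj₁ refl =
        subst (λ i → A (inj₁ i) (inj₁ (index v∈))) (index-cong c∈∁M u∈ refl) (centre-end v∈ uv)
      ... | inj₂ refl = A-sym (inj₁ (index v∈)) (inj₁ (index u∈))
        (subst (λ i → A (inj₁ i) (inj₁ (index u∈))) (index-cong c∈∁M v∈ refl)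
          (centre-end u∈ (adj-sym T uv)))
      from : A (inj₁ (index u∈)) (inj₁ (index v∈)) → Adj T u v
      from (inj₁ (u≡a , v≢a) , free) = subst (λ w → Adj T w v) (sym (index-injective u∈ c∈∁M u≡a))
        (end-centre v∈ v≢a λ i → free i ∘ subst (λ w → Joins a (leg i) w (index v∈)) (sym u≡a))
      from (inj₂ (v≡a , u≢a) , free) = adj-sym T (subst (λ w → Adj T w u)
        (sym (index-injective v∈ c∈∁M v≡a))
        (end-centre u∈ u≢a λ i → free i ∘ swap ∘ subst (λ w → Joins a (leg i) w (index u∈)) (sym v≡a)))

    flip⇔ : ∀ {u v} s t → Adj T v u ⇔ A t s → Adj T u v ⇔ A s t
    flip⇔ s t e = mk⇔ (A-sym t s ∘ Equivalence.to e ∘ adj-sym T)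
                              (adj-sym T ∘ Equivalence.from e ∘ A-sym s t)

  shape⇒IsSpider : ∀ {x} → x ≢ c → IsSpider ∣ M ∣ T
  shape⇒IsSpider {x} x≢c = ∣ ∁ M ∣ , star a , isStar , legs , splitBy M ,
    λ u v → splitBy-elim M (λ u s → Adj T u v ⇔ A s (Inverse.to (splitBy M) v))
      (λ u∈ → splitBy-elim M (λ v t → Adj T _ v ⇔ A _ t) (mid-mid u∈) (mid-end u∈) v)
      (λ u∈ → splitBy-elim M (λ v t → Adj T _ v ⇔ A _ t)
        (λ v∈ → flip⇔ (inj₁ (index u∈)) (inj₂ (index v∈)) (mid-end v∈ u∈)) (end-end u∈) v)
      u
    where
    isStar : IsStar (star a)
    -- The star needs a vertex besides its centre: `x` itself, or the foot of `x` if `x` is a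
    -- subdivision vertex.
    isStar with x ∈? M
    ... | yes x∈M = star-isStar λ eq → foot≢c x∈M (index-injective (foot∈∁M x∈M) c∈∁M eq)
    ... | no  x∉M = star-isStar λ eq → x≢c (index-injective (x∉p⇒x∈∁p x∉M) c∈∁M eq)

-- The equality case

degree≤Δ : (T : Graph (Fin n)) → ∀ v → degree T v ≤ Δ T
degree≤Δ T v = All.lookup (xs≤max 0 _) (∈-map⁺ (degree T) (∈-allFin v))

-- Any other pair outside B could be added to the 1-limited packing B to give a 2-limited one.
Tight : Graph (Fin n) → Subset n → Set
Tight T B = ∀ {x y} → x ≢ y → x ∉ B → y ∉ B →
  ∃[ v ] (Near T v x × Near T v y × ∃[ b ] (Near T v b × b ∈ B))

module _ (T : Graph (Fin n)) {B : Subset n} (pB : LimitedPacking T 1 B) where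

  -- If no suitable `v` exists, both vertices can be added to `B`, which exceeds `L 2 T` by one.
  L₂≡∣B∣+1⇒tight : ∣ B ∣ + 1 ≡ L 2 T → Tight T B
  L₂≡∣B∣+1⇒tight L₂≡ {x} {y} x≢y x∉B y∉B with any? (λ v → near? T v x ×-dec near? T v y ×-dec
                                                     any? (λ b → near? T v b ×-dec (b ∈? B)))
  ... | yes ∃v = ∃v
  ... | no ¬∃v = contradiction two-more
    (<⇒≱ (≤-reflexive (trans (cong suc (sym L₂≡)) (sym (+-suc ∣ B ∣ 1)))))
    where
    two-more : ∣ B ∣ + 2 ≤ L 2 T
    two-more = L₂-two-more T pB x≢y x∉B y∉B λ vx vy vb b∈B → ¬∃v (_ , vx , vy , _ , vb , b∈B)

  tight-centre : Rooted T → Tight T B → ∃[ z ] z ∉ B → ∃[ c ] (∀ {x} → x ∉ B → Near T c x)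
  tight-centre R tight missed = Rooted.helly R (λ x → ¬? (x ∈? B)) missed pairwise
    where
    pairwise : ∀ {x y} → x ∉ B → y ∉ B → ∃[ v ] (Near T v x × Near T v y)
    pairwise {x} {y} x∉B y∉B with x ≟ y
    ... | yes refl = x , inj₁ refl , inj₁ refl
    ... | no x≢y with v , vx , vy , _ ← tight x≢y x∉B y∉B = v , vx , vy

-- The spider around a vertex `c` near everything outside `B`.

module Centred (T : Graph (Fin n)) (isTree : IsTree T) {v₀ v₁ : Fin n} (v₀≢v₁ : v₀ ≢ v₁)
  {B : Subset n} (pB : LimitedPacking T 1 B) (tight : Tight T B)
  (c : Fin n) (missed-near : ∀ {x} → x ∉ B → Near T c x) where

  open IsTree isTree
  open Acyclic T acyclic

  far∈B : ∀ {x} → ¬ Near T c x → x ∈ B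
  far∈B {x} far = decidable-stable (x ∈? B) (far ∘ missed-near)

  beside∉B : ∀ {x y} → Adj T x y → x ∈ B → y ∉ B
  beside∉B xy x∈B y∈B = adj⇒≢ T xy (packing₁⇒≡ T pB (inj₁ refl) (inj₂ xy) x∈B y∈B)

  -- A vertex far from `c` is in `B`, so its neighbours are outside `B` and hence near `c`.
  beside-far : ∀ {x y} → ¬ Near T c x → Adj T x y → Adj T c y
  beside-far far xy with missed-near (beside∉B xy (far∈B far))
  ... | inj₁ refl = contradiction (inj₂ (adj-sym T xy)) far
  ... | inj₂ cy   = cy

  private
    Foot : Fin n → Fin n → Set
    Foot m b = Adj T m b × ¬ Near T c b

    foot? : ∀ m b → Dec (Foot m b)
    foot? m b = adj? T m b ×-dec ¬? (near? T c b)

    M? : Decidable λ m → Adj T c m × ∃[ b ] Foot m b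
    M? m = adj? T c m ×-dec any? (foot? m)

    M : Subset n
    M = select M?

    foot : Fin n → Fin n
    foot m with any? (foot? m)
    ... | yes (b , _) = b
    -- A default value, not reached for `m ∈ M`.
    ... | no  _       = m

    foot-Foot : ∀ {m} → m ∈ M → Foot m (foot m)
    foot-Foot {m} m∈M with any? (foot? m)
    ... | yes (_ , mb) = mb
    ... | no  ¬∃       = contradiction (proj₂ (∈-select⁻ M? m∈M)) ¬∃

    -- Two feet of `m` would both be members of `B` in `N[m]`.
    foot-unique : ∀ {m b} → m ∈ M → Foot m b → b ≡ foot m
    foot-unique m∈M (mb , b-far) with mf , f-far ← foot-Foot m∈M =
      packing₁⇒≡ T pB (inj₂ mb) (inj₂ mf) (far∈B b-far) (far∈B f-far)

    M⇒adj : ∀ {m} → m ∈ M → Adj T c m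
    M⇒adj m∈M = proj₁ (∈-select⁻ M? m∈M)

    far-beside∈M : ∀ {b m} → ¬ Near T c b → Adj T b m → m ∈ M
    far-beside∈M far bm = ∈-select⁺ M? (beside-far far bm , _ , adj-sym T bm , far)

  shape : SpiderShape T c
  shape = record
    { M = M
    ; foot = foot
    ; adj-centre = adj-sym T ∘ M⇒adj
    ; adj-foot = proj₁ ∘ foot-Foot
    ; adj-only = adj-only
    ; foot-injective = foot-injective
    ; foot≢c = λ m∈M f≡c → proj₂ (foot-Foot m∈M) (inj₁ f≡c)
    ; foot-far = λ m∈M cf → proj₂ (foot-Foot m∈M) (inj₂ cf)
    ; centre-edge = centre-edge
    ; short-leg = short-leg }
    where
    adj-only : ∀ {m x} → m ∈ M → Adj T m x → x ≡ c ⊎ x ≡ foot m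
    adj-only {m} {x} m∈M mx with near? T c x
    ... | yes (inj₁ x≡c) = inj₁ x≡c
    ... | yes (inj₂ cx)  = contradiction (adj-sym T cx) (no-triangle (M⇒adj m∈M) mx)
    ... | no  far        = inj₂ (foot-unique m∈M (mx , far))
    foot-injective : ∀ {l m} → l ∈ M → m ∈ M → foot l ≡ foot m → l ≡ m
    foot-injective {l} {m} l∈M m∈M eq with l ≟ m
    ... | yes l≡m = l≡m
    ... | no  l≢m with lf , far ← foot-Foot l∈M =
      contradiction (adj-sym T (M⇒adj m∈M)) (no-square (λ c≡f → far (inj₁ (sym c≡f))) l≢m
        (M⇒adj l∈M) lf (adj-sym T (subst (Adj T m) (sym eq) (proj₁ (foot-Foot m∈M)))))
    centre-edge : ∀ {u v} → u ∉ M → v ∉ M → Adj T u v → u ≡ c ⊎ v ≡ c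
    centre-edge {u} {v} u∉M v∉M uv with near? T c u | near? T c v
    ... | yes (inj₁ u≡c) | _              = inj₁ u≡c
    ... | yes (inj₂ _)   | yes (inj₁ v≡c) = inj₂ v≡c
    ... | yes (inj₂ cu)  | yes (inj₂ cv)  = contradiction (adj-sym T cv) (no-triangle cu uv)
    ... | yes (inj₂ _)   | no far = contradiction (far-beside∈M far (adj-sym T uv)) u∉M
    ... | no far         | _      = contradiction (far-beside∈M far uv) v∉M
    short-leg : ∀ {v} → v ∉ M → v ≢ c → (∀ {m} → m ∈ M → v ≢ foot m) → Adj T c v
    short-leg {v} v∉M v≢c not-foot with near? T c v
    ... | yes (inj₁ v≡c) = contradiction v≡c v≢c
    ... | yes (inj₂ cv)  = cv
    ... | no far with q , vq ← neighbour T connected v≢c =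
      contradiction (foot-unique q∈M (adj-sym T vq , far)) (not-foot q∈M)
      where
      q∈M : q ∈ M
      q∈M = far-beside∈M far vq

  private
    other-vertex : ∃[ x ] x ≢ c
    other-vertex with v₀ ≟ c
    ... | yes refl = v₁ , v₀≢v₁ ∘ sym
    ... | no v₀≢c  = v₀ , v₀≢c

    mid∉B : ∀ {m} → m ∈ M → m ∉ B
    mid∉B m∈M with mf , far ← foot-Foot m∈M = beside∉B (adj-sym T mf) (far∈B far)

    -- A neighbour of `c` outside `M` gives `c` degree above `∣ M ∣`. Otherwise tightness leaves a
    -- single leg, whose middle vertex `w` has the two neighbours `c` and `foot w`.
    ∣M∣<Δ : ∣ M ∣ < Δ T
    ∣M∣<Δ with any? (λ y → adj? T c y ×-dec ¬? (y ∈? M))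
    ... | yes (y , cy , y∉M) = ≤-trans (≤-reflexive (+-comm 1 ∣ M ∣)) (≤-trans
      (∣∣≥-disjoint (λ _ → y) (injective-Fin1 _) (∈-select⁺ (adj? T c) ∘ M⇒adj)
        (λ _ → ∈-select⁺ (adj? T c) cy) (λ _ → y∉M))
      (degree≤Δ T c))
    ... | no ¬short with w , cw ← neighbour T connected (proj₂ other-vertex ∘ sym) =
      ≤-trans (s≤s (∣∣≤-image {k = 1} (λ _ → w) λ x∈M → zero , only-leg x∈M))
        (≤-trans (∣∣≥-injection (pair c (foot w)) (pair-injective c≢foot) beside-w) (degree≤Δ T w))
      where
      ∈M : ∀ {y} → Adj T c y → y ∈ M
      ∈M {y} cy = decidable-stable (y ∈? M) λ y∉M → ¬short (y , cy , y∉M)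
      wf : Foot w (foot w)
      wf = foot-Foot (∈M cw)
      c≢foot : c ≢ foot w
      c≢foot eq = proj₂ wf (inj₁ (sym eq))
      beside-w : ∀ i → pair c (foot w) i ∈ N T w
      beside-w zero    = ∈-select⁺ (adj? T w) (adj-sym T cw)
      beside-w (suc _) = ∈-select⁺ (adj? T w) (proj₁ wf)
      -- All legs at c being subdivided, N[c] would miss B and hence two legs could be added to B.
      only-leg : ∀ {x} → x ∈ M → x ≡ w
      only-leg {x} x∈M with x ≟ w
      ... | yes x≡w = x≡w
      ... | no  x≢w with tight x≢w (mid∉B x∈M) (mid∉B (∈M cw))
      -- The closed neighbourhood supplied by tightness can only be `N[c]`.
      ... | v , vx , vw , b , vb , b∈B with common-near x≢w (M⇒adj x∈M) cw vx vw
      ... | refl with vb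
      ... | inj₂ cb   = contradiction b∈B (mid∉B (∈M cb))
      -- If `c` were in `B`, then `N[w]` would contain two members of `B`.
      ... | inj₁ refl = contradiction
        (packing₁⇒≡ T pB (inj₂ (adj-sym T cw)) (inj₂ (proj₁ wf)) b∈B (far∈B (proj₂ wf))) c≢foot

  isSpider : ∃[ t ] (t < Δ T × IsSpider t T)
  isSpider = ∣ M ∣ , ∣M∣<Δ , shape⇒IsSpider shape (proj₂ other-vertex)

-- Packings of spiders

-- Edges are listed with arbitrary orientation; these facts allow an edge at `a` to be handled
-- through its other end `o` whichever way it is listed.
module _ {V : Set} {e f a : V} where

  joins-end : ∀ {o x} → Joins e f a o → x ≡ e ⊎ x ≡ f → x ≡ a ⊎ x ≡ o
  joins-end (inj₁ (refl , refl)) x≡ = x≡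
  joins-end (inj₂ (refl , refl)) x≡ = swap x≡

  joins-unique : ∀ {o v} → Joins e f a o → Joins e f a v → v ≡ o
  joins-unique (inj₁ (_ , refl)) (inj₁ (_ , refl)) = refl
  joins-unique (inj₁ (refl , refl)) (inj₂ (refl , refl)) = refl
  joins-unique (inj₂ (refl , refl)) (inj₁ (refl , refl)) = refl
  joins-unique (inj₂ (refl , _)) (inj₂ (refl , _)) = refl

  joins-same : ∀ {e′ f′ o} → Joins e f a o → Joins e′ f′ a o → Joins e f e′ f′
  joins-same (inj₁ (refl , refl)) (inj₁ (refl , refl)) = inj₁ (refl , refl)
  joins-same (inj₁ (refl , refl)) (inj₂ (refl , refl)) = inj₂ (refl , refl)
  joins-same (inj₂ (refl , refl)) (inj₁ (refl , refl)) = inj₂ (refl , refl)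
  joins-same (inj₂ (refl , refl)) (inj₂ (refl , refl)) = inj₁ (refl , refl)

  joins-ends : ∀ {o} → Joins e f a o → (a ≡ e ⊎ a ≡ f) × (o ≡ e ⊎ o ≡ f)
  joins-ends (inj₁ (refl , refl)) = inj₁ refl , inj₂ refl
  joins-ends (inj₂ (refl , refl)) = inj₂ refl , inj₁ refl

module _ {S : Graph (Fin n)} (isStar : IsStar S) where
  open IsStar isStar
  open IsTree isTree

  private
    near-both : ∀ {u v ℓ} → Walk S u v ℓ → ℓ ≤ 2 → ∃[ w ] (Near S w u × Near S w v)
    near-both {u} nil                _ = u , inj₁ refl , inj₁ refl
    near-both {u} (cons uv nil)      _ = u , inj₁ refl , inj₂ uv
    near-both (cons uw (cons wv nil)) _ = _ , inj₂ (adj-sym S uw) , inj₂ wv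
    near-both (cons _ (cons _ (cons _ _))) (s≤s (s≤s ()))

    inhabited : ∀ {m} → 2 ≤ m → Fin m
    inhabited (s≤s _) = zero

    common-near-star : ∀ x y → ∃[ w ] (Near S w x × Near S w y)
    common-near-star x y with _ , (bound , _) , d≤2 ← diameter≤2
                         with _ , (w , _) , e≤d ← bound x y = near-both w (≤-trans e≤d d≤2)

  -- Diameter at most 2 makes any two vertices share a closed neighbourhood, so the Helly property
  -- applies to the whole vertex set.
  star-centre : ∃[ a ] (∀ x → Near S a x)
  star-centre with a , near ← Rooted.helly (rooted (inhabited nontrivial) isTree)
    {P = λ _ → ⊤} (λ _ → yes tt) (inhabited nontrivial , tt) (λ {x} {y} _ _ → common-near-star x y) =
    a , λ _ → near tt

  star-edge : ∀ {a x y} → (∀ x → Near S a x) → Adj S x y → x ≡ a ⊎ y ≡ a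
  star-edge {x = x} {y} near xy with near x | near y
  ... | inj₁ x≡a | _        = inj₁ x≡a
  ... | inj₂ _   | inj₁ y≡a = inj₂ y≡a
  ... | inj₂ ax  | inj₂ ay  = contradiction (adj-sym S ay) (Acyclic.no-triangle S acyclic ax xy)

-- A spider described inside `T`, with its `t` long legs indexed by `Fin t`. Short legs are
-- implicit: their ends fall under the first case of `cover`.
record Legs (T : Graph (Fin n)) (t : ℕ) : Set where
  field
    centre         : Fin n
    mid foot       : Fin t → Fin n
    foot-injective : ∀ {i j} → foot i ≡ foot j → i ≡ j
    foot≢centre    : ∀ i → foot i ≢ centre
    mid-centre     : ∀ i → Adj T (mid i) centre
    mid-foot       : ∀ i → Adj T (mid i) (foot i)
    mid-only       : ∀ {i x} → Adj T (mid i) x → x ≡ centre ⊎ x ≡ foot i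
    foot-only      : ∀ {i x} → Adj T (foot i) x → x ≡ mid i
    cover          : ∀ x → Near T centre x ⊎ ∃[ i ] x ≡ foot i

module _ {T : Graph (Fin n)} {t m : ℕ} {S : Graph (Fin m)} (isStar : IsStar S)
  {a : Fin m} (a-near : ∀ x → Near S a x) (E : Edges S t) (T≅ : T ≅ subdivide S E) where

  open Edges E

  private
    g : Fin m ⊎ Fin t → Fin n
    g = Inverse.from (proj₁ T≅)

    f : Fin n → Fin m ⊎ Fin t
    f = Inverse.to (proj₁ T≅)

    f-g : ∀ s → f (g s) ≡ s
    f-g s = Inverse.inverseˡ (proj₁ T≅) refl

    g-injective : ∀ {s s′} → g s ≡ g s′ → s ≡ s′
    g-injective {s} {s′} eq = trans (sym (f-g s)) (trans (cong f eq) (f-g s′))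

    -- Presents a vertex of `T` as the image of a vertex of the subdivided star, so that matching
    -- exposes which kind it is.
    data View : Fin n → Set where
      at : ∀ s → View (g s)

    view : ∀ x → View x
    view x = subst View (Inverse.inverseʳ (proj₁ T≅) refl) (at (f x))

    adj⁺ : ∀ s s′ → SubdividedAdj S E s s′ → Adj T (g s) (g s′)
    adj⁺ s s′ e = Equivalence.from (proj₂ T≅ (g s) (g s′))
      (subst₂ (SubdividedAdj S E) (sym (f-g s)) (sym (f-g s′)) e)

    adj⁻ : ∀ s s′ → Adj T (g s) (g s′) → SubdividedAdj S E s s′
    adj⁻ s s′ e = subst₂ (SubdividedAdj S E) (f-g s) (f-g s′)
      (Equivalence.to (proj₂ T≅ (g s) (g s′)) e)

    -- Every edge of the star contains its centre; the other end of a subdivided edge becomes the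
    -- foot.
    leg : ∀ i → ∃[ o ] (Joins (end₁ i) (end₂ i) a o × o ≢ a)
    leg i with star-edge isStar a-near (isEdge i)
    ... | inj₁ refl = end₂ i , inj₁ (refl , refl) , adj⇒≢ S (isEdge i) ∘ sym
    ... | inj₂ refl = end₁ i , inj₂ (refl , refl) , adj⇒≢ S (isEdge i)

    o : Fin t → Fin m
    o i = proj₁ (leg i)

    o-joins : ∀ i → Joins (end₁ i) (end₂ i) a (o i)
    o-joins i = proj₁ (proj₂ (leg i))

    o-injective : ∀ {i j} → o i ≡ o j → i ≡ j
    o-injective {i} {j} eq =
      distinct (joins-same (o-joins i) (subst (Joins (end₁ j) (end₂ j) a) (sym eq) (o-joins j)))

  spider-legs : Legs T t
  spider-legs = record
    { centre = g (inj₁ a)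
    ; mid = λ i → g (inj₂ i)
    ; foot = λ i → g (inj₁ (o i))
    ; foot-injective = λ eq → o-injective (inj₁-injective (g-injective eq))
    ; foot≢centre = λ i eq → proj₂ (proj₂ (leg i)) (inj₁-injective (g-injective eq))
    ; mid-centre = λ i → adj⁺ (inj₂ i) (inj₁ a) (proj₁ (joins-ends (o-joins i)))
    ; mid-foot = λ i → adj⁺ (inj₂ i) (inj₁ (o i)) (proj₂ (joins-ends (o-joins i)))
    ; mid-only = λ {i} {x} → mid-only i (view x)
    ; foot-only = λ {i} {x} → foot-only i (view x)
    ; cover = λ x → cover (view x) }
    where
    mid-only : ∀ i {x} → View x → Adj T (g (inj₂ i)) x → x ≡ g (inj₁ a) ⊎ x ≡ g (inj₁ (o i))
    mid-only i (at (inj₁ v)) e with joins-end (o-joins i) (adj⁻ (inj₂ i) (inj₁ v) e)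
    ... | inj₁ v≡a = inj₁ (cong (g ∘ inj₁) v≡a)
    ... | inj₂ v≡o = inj₂ (cong (g ∘ inj₁) v≡o)
    mid-only i (at (inj₂ j)) e = ⊥-elim (adj⁻ (inj₂ i) (inj₂ j) e)

    foot-only : ∀ i {x} → View x → Adj T (g (inj₁ (o i))) x → x ≡ g (inj₂ i)
    -- The only star edge at the foot leads to the centre, and the subdivision has removed it.
    foot-only i (at (inj₁ v)) e with adj⁻ (inj₁ (o i)) (inj₁ v) e
    ... | ov , free with star-edge isStar a-near ov
    ... | inj₁ o≡a = contradiction o≡a (proj₂ (proj₂ (leg i)))
    ... | inj₂ refl = contradiction (swap (o-joins i)) (free i)
    foot-only i (at (inj₂ j)) e with joins-end (o-joins j) (adj⁻ (inj₁ (o i)) (inj₂ j) e)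
    ... | inj₁ o≡a = contradiction o≡a (proj₂ (proj₂ (leg i)))
    ... | inj₂ o≡o = cong (g ∘ inj₂) (sym (o-injective o≡o))

    cover : ∀ {x} → View x → Near T (g (inj₁ a)) x ⊎ ∃[ i ] x ≡ g (inj₁ (o i))
    cover (at (inj₂ i)) = inj₁ (inj₂ (adj⁺ (inj₁ a) (inj₂ i) (proj₁ (joins-ends (o-joins i)))))
    cover (at (inj₁ v)) with a-near v | any? (λ i → v ≟ o i)
    ... | inj₁ v≡a | _             = inj₁ (inj₁ (cong (g ∘ inj₁) v≡a))
    ... | inj₂ _   | yes (i , v≡o) = inj₂ (i , cong (g ∘ inj₁) v≡o)
    ... | inj₂ av  | no ¬o         = inj₁ (inj₂ (adj⁺ (inj₁ a) (inj₁ v)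
      (av , λ i joins → ¬o (i , joins-unique (o-joins i) joins))))

-- Bounds on `L 1` and `L 2` from families of vertices.

L₁-lower : (T : Graph (Fin n)) (h : Fin k → Fin n) →
           (∀ {v i j} → Near T v (h i) → Near T v (h j) → i ≡ j) → k ≤ L 1 T
L₁-lower {n} {k} T h apart = ≤-trans
  (∣∣≥-injection h (λ eq → apart (inj₁ refl) (inj₁ (sym eq))) (λ i → ∈-select⁺ H? (i , refl)))
  (L-upper 1 T (select H?) (≡⇒packing₁ T unique))
  where
  H? : Decidable λ x → ∃[ i ] x ≡ h i
  H? x = any? (λ i → x ≟ h i)
  unique : ∀ {v x y} → Near T v x → Near T v y → x ∈ select H? → y ∈ select H? → x ≡ y
  unique vx vy x∈ y∈ with ∈-select⁻ H? x∈ | ∈-select⁻ H? y∈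
  ... | i , refl | j , refl = cong h (apart vx vy)

-- A 2-limited packing has at most two members in `N[c]`, and all its others are values of `h`.
L₂-upper : (T : Graph (Fin n)) (c : Fin n) (h : Fin k → Fin n) →
           (∀ x → Near T c x ⊎ ∃[ i ] x ≡ h i) → L 2 T ≤ 2 + k
L₂-upper {k = k} T c h cover with B , pB , ∣B∣≡L ← L-attained 2 T = begin
  L 2 T                  ≡⟨ ∣B∣≡L ⟨
  ∣ B ∣                  ≤⟨ ∣∣≤-cover h split ⟩
  ∣ N[_] T c ∩ B ∣ + k   ≤⟨ +-monoˡ-≤ k (pB c) ⟩
  2 + k                  ∎
  where
  open ≤-Reasoning
  split : ∀ {x} → x ∈ B → x ∈ N[_] T c ∩ B ⊎ ∃[ i ] x ≡ h i
  split {x} x∈B with cover x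
  ... | inj₁ cx = inj₁ (x∈p∩q⁺ (near⇒∈ T cx , x∈B))
  ... | inj₂ x≡ = inj₂ x≡

<Δ⇒<degree : (T : Graph (Fin n)) → ∀ {t} → t < Δ T → ∃[ v ] t < degree T v
<Δ⇒<degree {n} T {t} t<Δ with argmax-sel id 0 (map (degree T) (allFin n))
-- The default value 0 of `max` lies above no `t`.
... | inj₁ Δ≡0 with () ← subst (t <_) Δ≡0 t<Δ
<Δ⇒<degree T {t} t<Δ | inj₂ Δ∈ with v , _ , Δ≡ ← ∈-map⁻ (degree T) Δ∈ = v , subst (t <_) Δ≡ t<Δ

module _ {T : Graph (Fin n)} {t : ℕ} (legs : Legs T t) where
  open Legs legs

  private
    foot≁centre : ∀ i → ¬ Adj T (foot i) centre
    foot≁centre i fc = irrefl T (subst (Adj T (mid i)) (foot-only fc) (mid-centre i))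

    near-foot : ∀ {v i} → Near T v (foot i) → v ≡ foot i ⊎ v ≡ mid i
    near-foot (inj₁ f≡v) = inj₁ (sym f≡v)
    near-foot (inj₂ vf)  = inj₂ (foot-only (adj-sym T vf))

    foot≢mid : ∀ {i j} → foot i ≢ mid j
    foot≢mid {i} {j} eq = foot≁centre i (subst (λ x → Adj T x centre) (sym eq) (mid-centre j))

    mid-injective : ∀ {i j} → mid i ≡ mid j → i ≡ j
    mid-injective {i} {j} eq with mid-only (subst (λ x → Adj T x (foot i)) eq (mid-foot i))
    ... | inj₁ f≡c = contradiction f≡c (foot≢centre i)
    ... | inj₂ f≡f = foot-injective f≡f

    feet-apart : ∀ {v i j} → Near T v (foot i) → Near T v (foot j) → i ≡ j
    feet-apart vi vj with near-foot vi | near-foot vj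
    ... | inj₁ refl | inj₁ eq = foot-injective eq
    ... | inj₁ refl | inj₂ eq = contradiction eq foot≢mid
    ... | inj₂ refl | inj₁ eq = contradiction (sym eq) foot≢mid
    ... | inj₂ refl | inj₂ eq = mid-injective eq

    -- A vertex near a foot is that foot or its middle vertex, and neither is near the end `y` of a
    -- short leg; hence `y` can join the `t` feet.
    short-leg⇒L₁ : ∀ {y} → Adj T centre y → (∀ i → y ≢ mid i) → suc t ≤ L 1 T
    short-leg⇒L₁ {y} cy y≢mid = L₁-lower T h apart
      where
      h : Fin (suc t) → Fin n
      h zero    = y
      h (suc i) = foot i
      y≢foot : ∀ {i} → y ≢ foot i
      y≢foot {i} refl = foot≁centre i (adj-sym T cy)
      y-apart : ∀ {v i} → Near T v y → ¬ Near T v (foot i)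
      y-apart vy vf with near-foot vf | vy
      ... | inj₁ refl | inj₁ y≡f = y≢foot y≡f
      ... | inj₁ refl | inj₂ fy  = y≢mid _ (foot-only fy)
      ... | inj₂ refl | inj₁ y≡m = y≢mid _ y≡m
      ... | inj₂ refl | inj₂ my with mid-only my
      ... | inj₁ y≡c = adj⇒≢ T cy (sym y≡c)
      ... | inj₂ y≡f = y≢foot y≡f
      apart : ∀ {v i j} → Near T v (h i) → Near T v (h j) → i ≡ j
      apart {i = zero}  {zero}  _  _  = refl
      apart {i = zero}  {suc _} vi vj = contradiction vj (y-apart vi)
      apart {i = suc _} {zero}  vi vj = contradiction vi (y-apart vj)
      apart {i = suc _} {suc _} vi vj = cong suc (feet-apart vi vj)

    no-short⇒long : ¬ (∃[ y ] (Adj T centre y × ∀ i → y ≢ mid i)) →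
                    ∀ {y} → Adj T centre y → ∃[ i ] y ≡ mid i
    no-short⇒long ¬short {y} cy = decidable-stable (any? (λ i → y ≟ mid i))
      λ ¬mid → ¬short (y , cy , λ i y≡mid → ¬mid (i , y≡mid))

    module AllLong (long : ∀ {y} → Adj T centre y → ∃[ i ] y ≡ mid i) where

      degree-centre : degree T centre ≤ t
      degree-centre = ∣∣≤-image mid λ x∈ → long (∈-select⁻ (adj? T centre) x∈)

      -- A foot has one neighbour, and the existence of `i` gives `1 ≤ t`.
      degree-foot : ∀ i → degree T (foot i) ≤ t
      degree-foot i = ∣∣≤-image (λ _ → mid i) λ x∈ → i , foot-only (∈-select⁻ (adj? T (foot i)) x∈)

      -- The two possible neighbours are listed by a family of length `t`: the centre at position
      -- `i`, the foot at the different position `j`.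
      degree-mid : ∀ {i j} → i ≢ j → degree T (mid i) ≤ t
      degree-mid {i} {j} i≢j = ∣∣≤-image h λ x∈ → covered (∈-select⁻ (adj? T (mid i)) x∈)
        where
        h : Fin t → Fin n
        h l with i ≟ l
        ... | yes _ = centre
        ... | no  _ = foot i
        h-i : h i ≡ centre
        h-i with i ≟ i
        ... | yes _  = refl
        ... | no i≢i = contradiction refl i≢i
        h-j : h j ≡ foot i
        h-j with i ≟ j
        ... | yes i≡j = contradiction i≡j i≢j
        ... | no _    = refl
        covered : ∀ {x} → Adj T (mid i) x → ∃[ l ] x ≡ h l
        covered mx with mid-only mx
        ... | inj₁ x≡c = i , trans x≡c (sym h-i)
        ... | inj₂ x≡f = j , trans x≡f (sym h-j)

      -- With no short leg at the centre, a vertex of degree above t exists only on the path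
      -- with three vertices, whose middle vertex is then some mid i.
      dominated : t < Δ T → ∃[ i ] (∀ x → Near T (mid i) x)
      dominated t<Δ with <Δ⇒<degree T t<Δ
      ... | w , t<deg with cover w
      ... | inj₂ (i , refl) = contradiction (degree-foot i) (<⇒≱ t<deg)
      ... | inj₁ (inj₁ refl) = contradiction degree-centre (<⇒≱ t<deg)
      ... | inj₁ (inj₂ cw) with long cw
      ... | i , refl = i , near
        where
        -- A second leg would bring the degree of `mid i` down to at most `t`.
        only : ∀ j → i ≡ j
        only j = decidable-stable (i ≟ j) λ i≢j → <⇒≱ t<deg (degree-mid i≢j)
        near : ∀ x → Near T (mid i) x
        near x with cover x
        ... | inj₁ (inj₁ refl) = inj₂ (mid-centre i)
        ... | inj₁ (inj₂ cx) with j , refl ← long cx = inj₁ (cong mid (sym (only j)))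
        near x | inj₂ (j , refl) = inj₂ (subst (λ l → Adj T (mid i) (foot l)) (only j) (mid-foot i))

  -- A short leg gives `t + 2` above `L 2 T` and `t + 1` below `L 1 T`. Without one, some `mid i`
  -- dominates `T`, so `L 2 T` is at most 2 while a single vertex is a 1-limited packing.
  legs⇒L₂≤L₁+1 : t < Δ T → L 2 T ≤ L 1 T + 1
  legs⇒L₂≤L₁+1 t<Δ with any? (λ y → adj? T centre y ×-dec all? (λ i → ¬? (y ≟ mid i)))
  ... | yes (y , cy , y≢mid) = begin
    L 2 T       ≤⟨ L₂-upper T centre foot cover ⟩
    2 + t       ≤⟨ s≤s (short-leg⇒L₁ cy y≢mid) ⟩
    1 + L 1 T   ≡⟨ +-comm 1 (L 1 T) ⟩
    L 1 T + 1   ∎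
    where open ≤-Reasoning
  ... | no ¬short with i , near ← AllLong.dominated (no-short⇒long ¬short) t<Δ = begin
    L 2 T       ≤⟨ L₂-upper {k = 0} T (mid i) (λ ()) (inj₁ ∘ near) ⟩
    1 + 1       ≤⟨ +-monoˡ-≤ 1 (L₁-lower {k = 1} T (λ _ → centre) λ _ _ → Fin1-unique _ _) ⟩
    L 1 T + 1   ∎
    where
    open ≤-Reasoning

-- The lower bound and the two directions of the equality case.

module _ {T : Graph (Fin n)} (isTree : IsTree T) (R : Rooted T) {v₀ v₁ : Fin n} (v₀≢v₁ : v₀ ≢ v₁) where
  open IsTree isTree

  L₁+1≤L₂ : L 1 T + 1 ≤ L 2 T
  L₁+1≤L₂ with B , pB , ∣B∣≡L₁ ← L-attained 1 T =
    subst (λ l → l + 1 ≤ L 2 T) ∣B∣≡L₁ (L₂-one-more T pB (proj₂ (missed-vertex T connected v₀≢v₁ pB)))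

  L₂≡L₁+1⇒spider : L 1 T + 1 ≡ L 2 T → ∃[ t ] ((t < Δ T) × IsSpider t T)
  L₂≡L₁+1⇒spider L₂≡ with B , pB , ∣B∣≡L₁ ← L-attained 1 T
    with tight ← (λ {x y} → L₂≡∣B∣+1⇒tight T pB (trans (cong (_+ 1) ∣B∣≡L₁) L₂≡) {x} {y})
    with c , near ← tight-centre T pB R tight (missed-vertex T connected v₀≢v₁ pB) =
    Centred.isSpider T isTree v₀≢v₁ pB tight c near

  spider⇒L₂≡L₁+1 : ∃[ t ] ((t < Δ T) × IsSpider t T) → L 1 T + 1 ≡ L 2 T
  spider⇒L₂≡L₁+1 (_ , t<Δ , _ , _ , isStar , E , T≅) =
    ≤-antisym L₁+1≤L₂ (legs⇒L₂≤L₁+1 {T = T} (spider-legs isStar (proj₂ (star-centre isStar)) E T≅) t<Δ)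

theorem5p3 : ∀ {n : ℕ} (T : Graph (Fin n)) → 2 ≤ n → IsTree T →
    ((L 1 T + 1 ≤ L 2 T) × (L 2 T ≤ 2 * L 1 T))
    × ((L 1 T + 1 ≡ L 2 T) ⇔ (∃[ t ] ((t < Δ T) × IsSpider t T)))
theorem5p3 T (s≤s (s≤s _)) isTree =
  (L₁+1≤L₂ isTree R 0≢1 , L₂≤2L₁ R) ,
  mk⇔ (L₂≡L₁+1⇒spider isTree R 0≢1) (spider⇒L₂≡L₁+1 isTree R 0≢1)
  where
  0≢1 : Fin.zero ≢ suc zero
  0≢1 ()
  R : Rooted T
  R = rooted zero isTree
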